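{- Call a permutation $\pi$ triangular if $\pi_1=1$ and its consecutive-minima polygon $P_\pi$ has at most $3$ faces. For each $n\ge 0$, the number of triangular permutations of length $n+2$ is $\binom{2n}{n}$. Moreover, letting $t_{n;1,a}$ denote the number of triangular permutations $\pi$ of length $n$ with $\pi_1=1$ and $\pi_2=a$, the generating function $t(v;x)=\sum_{n\geq 2}\sum_{a=2}^{n}t_{n;1,a}v^{a-2}x^{n}$ is given by $$t(v;x)=\frac{x^{2}(1-v)(1-xv)^{2}}{(1-2xv)(1-v+xv^{2})}+\frac{x^{3}}{1-v+xv^{2}}\cdot \frac{1}{\sqrt{1-4x}}.$$
   Context: A permutation $\pi=\pi_1\pi_2\cdots\pi_n$ of $[n]=\{1,\dots,n\}$ is identified with the set of grid points $L_\pi=\{(i,\pi_i): 1\le i\le n\}$. A point $(i,j)\in L_\pi$ is a left-right minimum if there is no $(i',j')\in L_\pi$ with $i'<i$ and $j'<j$; it is a right-left minimum if there is no $(i',j')\in L_\pi$ with $i'>i$ and $j'<j$; it is a source if $i=1$, or $i=n$, or it is neither a left-right minimum nor a right-left minimum. Two points $(i,j),(i',j')$ of one of these three sets are consecutive (in that set) if no point $(a,b)$ of the same set satisfies $i<a<i'$ or $i'<a<i$. The consecutive-minima polygon $P_\pi$ has vertex set $L_\pi$, and two vertices $(i,j),(i',j')$ with $i<i'$ are joined by an edge if they are consecutive left-right minima, or consecutive right-left minima, or consecutive sources. An edge $((i,j),(i',j'))$ with $i<i'$ is increasing if $j<j'$ and decreasing if $j>j'$. A path is a sequence of edges $(a_0,a_1),(a_1,a_2),\dots,(a_{s-1},a_s)$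 of $P_\pi$. A face of $P_\pi$ is either a maximal path of increasing edges or a maximal path of decreasing edges; the number of faces of $P_\pi$ is the number of such maximal paths. -}

module Defs where

open import Data.Bool using (Bool; true; false; _∧_; _∨_; not; if_then_else_)
open import Data.Nat using (ℕ; zero; suc; _<ᵇ_; _≡ᵇ_; _≤ᵇ_; _∸_; _+_)
open import Data.List using (List; []; _∷_; map; concatMap; null; upTo; filterᵇ; length)
open import Data.Bool.ListAction using (all; any)
open import Data.Integer using (ℤ; +_; -_) renaming (_+_ to _+ℤ_; _*_ to _*ℤ_)
open import Relation.Binary.PropositionalEquality using (_≡_)

-- Permutations as lists of values π₁ … πₙ (positions are 1-indexed).

-- at π i = π_i  (1-indexed; 0 outside the range 1..length π)
at : List ℕ → ℕ → ℕ
at []       _             = 0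
at (x ∷ xs) zero          = 0
at (x ∷ xs) (suc zero)    = x
at (x ∷ xs) (suc (suc k)) = at xs (suc k)

posns : ℕ → List ℕ
posns n = map suc (upTo n)

isPerm : ℕ → List ℕ → Bool
isPerm m π = (length π ≡ᵇ m) ∧ all (λ v → any (λ w → v ≡ᵇ w) π) (posns m)

words : ℕ → ℕ → List (List ℕ)
words zero    m = [] ∷ []
words (suc k) m = concatMap (λ x → map (x ∷_) (words k m)) (posns m)

perms : ℕ → List (List ℕ)
perms m = filterᵇ (isPerm m) (words m m)

module _ (π : List ℕ) where
  private
    n = length π

  isLRmin : ℕ → Bool
  isLRmin i = all (λ k → not ((k <ᵇ i) ∧ (at π k <ᵇ at π i))) (posns n)

  isRLmin : ℕ → Bool
  isRLmin i = all (λ k → not ((i <ᵇ k) ∧ (at π k <ᵇ at π i))) (posns n)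

  isSource : ℕ → Bool
  isSource i = (i ≡ᵇ 1) ∨ (i ≡ᵇ n) ∨ (not (isLRmin i) ∧ not (isRLmin i))

  consec : (ℕ → Bool) → ℕ → ℕ → Bool
  consec S i k = S i ∧ S k ∧ (i <ᵇ k)
                 ∧ all (λ a → not (S a ∧ (i <ᵇ a) ∧ (a <ᵇ k))) (posns n)

  isEdge : ℕ → ℕ → Bool
  isEdge i k = (i <ᵇ k)
             ∧ (consec isLRmin i k ∨ consec isRLmin i k ∨ consec isSource i k)

  incEdge : ℕ → ℕ → Bool
  incEdge i k = isEdge i k ∧ (at π i <ᵇ at π k)

  decEdge : ℕ → ℕ → Bool
  decEdge i k = isEdge i k ∧ (at π k <ᵇ at π i)

  -- Maximal paths (a₀,a₁),(a₁,a₂),… of edges of relation E (edges go from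
  -- the left endpoint to the right endpoint), listed by vertex sequences.
  -- pathsFrom fuel E v : all maximal E-paths starting at v that cannot be
  -- extended at the end (fuel ≥ n suffices since positions strictly increase).
  pathsFrom : ℕ → (ℕ → ℕ → Bool) → ℕ → List (List ℕ)
  pathsFrom zero    E v = (v ∷ []) ∷ []
  pathsFrom (suc f) E v with filterᵇ (E v) (posns n)
  ... | []       = (v ∷ []) ∷ []
  ... | (w ∷ ws) = concatMap (λ u → map (v ∷_) (pathsFrom f E u)) (w ∷ ws)

  maximalPaths : (ℕ → ℕ → Bool) → List (List ℕ)
  maximalPaths E =
    concatMap (pathsFrom n E)
      (filterᵇ (λ v → null (filterᵇ (λ u → E u v) (posns n))
                      ∧ not (null (filterᵇ (E v) (posns n))))
               (posns n))

  faces : ℕ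
  faces = length (maximalPaths incEdge) + length (maximalPaths decEdge)

  triangular : Bool
  triangular = (at π 1 ≡ᵇ 1) ∧ (faces ≤ᵇ 3)

numTriangular : ℕ → ℕ
numTriangular m = length (filterᵇ triangular (perms m))

tcount : ℕ → ℕ → ℕ
tcount n a = length (filterᵇ (λ π → triangular π ∧ (at π 1 ≡ᵇ 1) ∧ (at π 2 ≡ᵇ a))
                             (perms n))

-- Formal power series in two variables v, x over ℤ:
-- F i j is the coefficient of v^i x^j.

FPS : Set
FPS = ℕ → ℕ → ℤ

sumTo : ℕ → (ℕ → ℤ) → ℤ
sumTo zero    f = f 0
sumTo (suc k) f = sumTo k f +ℤ f (suc k)

_⊕_ : FPS → FPS → FPS
(F ⊕ G) i j = F i j +ℤ G i j

_⊛_ : FPS → FPS → FPS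
(F ⊛ G) i j = sumTo i (λ a → sumTo j (λ b → F a b *ℤ G (i ∸ a) (j ∸ b)))

infixl 6 _⊕_
infixl 7 _⊛_

mono : ℤ → ℕ → ℕ → FPS
mono c p q i j = if (i ≡ᵇ p) ∧ (j ≡ᵇ q) then c else + 0

oneS : FPS
oneS = mono (+ 1) 0 0

_≈S_ : FPS → FPS → Set
F ≈S G = ∀ i j → F i j ≡ G i j

infix 4 _≈S_

tSeries : FPS
tSeries i j = if (2 ≤ᵇ j) ∧ (i + 2 ≤ᵇ j) then + tcount j (i + 2) else + 0

denomE : FPS
denomE = oneS ⊕ mono (- + 1) 1 0 ⊕ mono (+ 1) 2 1

denomD : FPS
denomD = (oneS ⊕ mono (- + 2) 1 1) ⊛ denomE

numerA : FPS
numerA = mono (+ 1) 0 2 ⊛ (oneS ⊕ mono (- + 1) 1 0)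
         ⊛ (oneS ⊕ mono (- + 1) 1 1) ⊛ (oneS ⊕ mono (- + 1) 1 1)

oneMinus4x : FPS
oneMinus4x = oneS ⊕ mono (- + 4) 0 1

{-# OPTIONS --safe #-}

-- Since π₁ = 1, position 1 is the only left-right minimum, and P_π consists of the increasing path
-- through the right-left minima and the path through the sources, which share their end points. For
-- length at least 3 the number of faces is 2 plus the numbers of valleys and of peaks of the source
-- path. That path starts with an ascent, so every valley comes after a peak, and π is triangular if
-- and only if its source path has no valley.
--
-- Read such a π from left to right, and let p and q be the numbers of unread values below and above
-- the largest source read so far. The number f(p,q) of ways to finish satisfies
-- f(p,q) = f(p-1,q) + f(p+1,q-1) for q ≥ 2, whence f(p,q+1) = Σ_{i≤p} C(p+2q,q+i). In particular
-- there are f(0,n+1) = C(2n,n) triangular permutations of length n+2, and t_{n;1,a} = f(a-2,n-a).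
--
-- In terms of t the recurrence is (1-v+xv²) t = x³ Σₖ C(2k,k) xᵏ + x²(1-v)(1-xv)²/(1-2xv). Finally
-- Σₖ C(2k,k) xᵏ is the only series S with S² (1-4x) = 1 and constant term 1: it is a solution by
-- (k+1) C(2k+2,k+1) = (4k+2) C(2k,k), and two solutions S, S′ satisfy (S+S′)(S-S′) = 0, where S+S′
-- has constant term 2 and so is not a zero divisor.

module Submission where

open import Defs
open import Algebra.Bundles using (CommutativeRing)
open import Data.Nat.Base as ℕ using (ℕ; zero; suc)
import Data.Nat.Properties as ℕ
open import Data.Product using (∃; _×_; _,_; proj₁; proj₂)
open import Function.Base using (_∘_; id)

-- Formal power series over a commutative ring

-- The recurrence has only two terms although the next larger source can be any of q values. Let
-- U(p,q) count the words whose next entry exceeds the largest source M. The smallest value above M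
-- is either taken, leaving f(p,q-1) words, or skipped, which puts it below and leaves U(p+1,q-1).
-- From the state (p+1,q-1) with q ≥ 2, the next entry is either the smallest unread value, again
-- leaving f(p,q-1), or one above M. Hence U(p,q) = f(p+1,q-1). The case q = 1 differs: nothing can
-- be skipped, so U(p,1) = f(p,0). For q = 0 every entry but the last is the smallest or the largest
-- unread value, so f(p,0) is 2^(p-1) for p ≥ 1. These two boundary cases are the origin of the term
-- with (1-xv)²/(1-2xv). The number of faces enters through two bounds: at most 2 + 1 without a
-- valley, at least 3 + 1 with one. A maximal path is traced from a vertex with no incoming edge of
-- its direction, and position 1 is the only vertex where increasing paths branch.

module PowerSeries {c ℓ} (R : CommutativeRing c ℓ) where
  open CommutativeRing R
  open import Algebra.Properties.CommutativeSemigroup +-commutativeSemigroup using (interchange)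
  open import Relation.Binary.Reasoning.Setoid setoid

  -- The recursion peels off the lowest coefficient of the left factor, so the ring laws below are
  -- inductions over the tail `F ∘ suc`. The resulting ring can again serve as coefficients, which
  -- gives series in two variables.
  conv : (ℕ → Carrier) → (ℕ → Carrier) → ℕ → Carrier
  conv F G zero    = F 0 * G 0
  conv F G (suc n) = F 0 * G (suc n) + conv (F ∘ suc) G n

  one : ℕ → Carrier
  one zero    = 1#
  one (suc _) = 0#

  conv-cong : ∀ {F F′ G G′} → (∀ n → F n ≈ F′ n) → (∀ n → G n ≈ G′ n) → ∀ n → conv F G n ≈ conv F′ G′ n
  conv-cong p q zero    = *-cong (p 0) (q 0)
  conv-cong p q (suc n) = +-cong (*-cong (p 0) (q (suc n))) (conv-cong (p ∘ suc) q n)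

  conv-distribˡ : ∀ F G H n → conv F (λ k → G k + H k) n ≈ conv F G n + conv F H n
  conv-distribˡ F G H zero    = distribˡ _ _ _
  conv-distribˡ F G H (suc n) =
    trans (+-cong (distribˡ _ _ _) (conv-distribˡ (F ∘ suc) G H n)) (interchange _ _ _ _)

  conv-distribʳ : ∀ F G H n → conv (λ k → G k + H k) F n ≈ conv G F n + conv H F n
  conv-distribʳ F G H zero    = distribʳ _ _ _
  conv-distribʳ F G H (suc n) =
    trans (+-cong (distribʳ _ _ _) (conv-distribʳ F (G ∘ suc) (H ∘ suc) n)) (interchange _ _ _ _)

  conv-scale : ∀ a F G n → conv (λ k → a * F k) G n ≈ a * conv F G n
  conv-scale a F G zero    = *-assoc _ _ _
  conv-scale a F G (suc n) =
    trans (+-cong (*-assoc _ _ _) (conv-scale a (F ∘ suc) G n)) (sym (distribˡ _ _ _))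

  conv-assoc : ∀ F G H n → conv (conv F G) H n ≈ conv F (conv G H) n
  conv-assoc F G H zero    = *-assoc _ _ _
  conv-assoc F G H (suc n) = begin
    F 0 * G 0 * H (suc n) + conv (λ k → F 0 * G (suc k) + conv (F ∘ suc) G k) H n
      ≈⟨ +-cong (*-assoc _ _ _) (conv-distribʳ H (λ k → F 0 * G (suc k)) (conv (F ∘ suc) G) n) ⟩
    F 0 * (G 0 * H (suc n)) + (conv (λ k → F 0 * G (suc k)) H n + conv (conv (F ∘ suc) G) H n)
      ≈⟨ +-congˡ (+-cong (conv-scale (F 0) (G ∘ suc) H n) (conv-assoc (F ∘ suc) G H n)) ⟩
    F 0 * (G 0 * H (suc n)) + (F 0 * conv (G ∘ suc) H n + conv (F ∘ suc) (conv G H) n)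
      ≈⟨ +-assoc _ _ _ ⟨
    F 0 * (G 0 * H (suc n)) + F 0 * conv (G ∘ suc) H n + conv (F ∘ suc) (conv G H) n
      ≈⟨ +-congʳ (distribˡ _ _ _) ⟨
    F 0 * (G 0 * H (suc n) + conv (G ∘ suc) H n) + conv (F ∘ suc) (conv G H) n ∎

  -- The mirror image of the defining recursion: commutativity and cancellation need the split at
  -- the right factor.
  conv-sucʳ : ∀ F G n → conv F G (suc n) ≈ conv F (G ∘ suc) n + F (suc n) * G 0
  conv-sucʳ F G zero    = refl
  conv-sucʳ F G (suc n) =
    trans (+-congˡ (conv-sucʳ (F ∘ suc) G n)) (sym (+-assoc _ _ _))

  conv-comm : ∀ F G n → conv F G n ≈ conv G F n
  conv-comm F G zero    = *-comm _ _
  conv-comm F G (suc n) = begin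
    F 0 * G (suc n) + conv (F ∘ suc) G n ≈⟨ +-cong (*-comm _ _) (conv-comm (F ∘ suc) G n) ⟩
    G (suc n) * F 0 + conv G (F ∘ suc) n ≈⟨ +-comm _ _ ⟩
    conv G (F ∘ suc) n + G (suc n) * F 0 ≈⟨ conv-sucʳ G F n ⟨
    conv G F (suc n) ∎

  conv-zeroˡ : ∀ {F} G → (∀ k → F k ≈ 0#) → ∀ n → conv F G n ≈ 0#
  conv-zeroˡ G z zero    = trans (*-congʳ (z 0)) (zeroˡ _)
  conv-zeroˡ G z (suc n) =
    trans (+-cong (trans (*-congʳ (z 0)) (zeroˡ _)) (conv-zeroˡ G (z ∘ suc) n)) (+-identityˡ _)

  conv-identityˡ : ∀ F n → conv one F n ≈ F n
  conv-identityˡ F zero    = *-identityˡ _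
  conv-identityˡ F (suc n) =
    trans (+-cong (*-identityˡ _) (conv-zeroˡ F (λ _ → refl) n)) (+-identityʳ _)

  -- Degree 0 gives G 0 = 0, and then `conv-sucʳ` shows that F annihilates the tail of G as well.
  -- Regularity of the constant term is assumed rather than invertibility, since 2 has no inverse in
  -- ℤ; the conclusion is again regularity, so the lemma can be iterated in a second variable.
  conv-cancel : ∀ F → (∀ a → F 0 * a ≈ 0# → a ≈ 0#) → ∀ G → (∀ n → conv F G n ≈ 0#) → ∀ n → G n ≈ 0#
  conv-cancel F regular G z zero    = regular (G 0) (z 0)
  conv-cancel F regular G z (suc n) = conv-cancel F regular (G ∘ suc) z′ n
    where
    z′ : ∀ n → conv F (G ∘ suc) n ≈ 0#
    z′ n = begin
      conv F (G ∘ suc) n                   ≈⟨ +-identityʳ _ ⟨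
      conv F (G ∘ suc) n + 0#              ≈⟨ +-congˡ (trans (*-congˡ (regular (G 0) (z 0))) (zeroʳ _)) ⟨
      conv F (G ∘ suc) n + F (suc n) * G 0 ≈⟨ conv-sucʳ F G n ⟨
      conv F G (suc n)                     ≈⟨ z (suc n) ⟩
      0#                                   ∎

  commutativeRing : CommutativeRing c ℓ
  commutativeRing = record
    { Carrier = ℕ → Carrier
    ; _≈_     = λ F G → ∀ n → F n ≈ G n
    ; _+_     = λ F G n → F n + G n
    ; _*_     = conv
    ; -_      = λ F n → - F n
    ; 0#      = λ _ → 0#
    ; 1#      = one
    ; isCommutativeRing = record
      { isRing = record
        { +-isAbelianGroup = record
          { isGroup = record
            { isMonoid = record
              { isSemigroup = record
                { isMagma = record
                  { isEquivalence = record
                    { refl = λ _ → refl ; sym = λ p n → sym (p n) ; trans = λ p q n → trans (p n) (q n) }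
                  ; ∙-cong = λ p q n → +-cong (p n) (q n) }
                ; assoc = λ _ _ _ _ → +-assoc _ _ _ }
              ; identity = (λ _ _ → +-identityˡ _) , (λ _ _ → +-identityʳ _) }
            ; inverse = (λ _ _ → -‿inverseˡ _) , (λ _ _ → -‿inverseʳ _)
            ; ⁻¹-cong = λ p n → -‿cong (p n) }
          ; comm = λ _ _ _ → +-comm _ _ }
        ; *-cong = conv-cong
        ; *-assoc = conv-assoc
        ; *-identity = conv-identityˡ , λ F n → trans (conv-comm F one n) (conv-identityˡ F n)
        ; distrib = conv-distribˡ , conv-distribʳ }
      ; *-comm = conv-comm } }

open import Data.Nat.Combinatorics using (_C_)
open import Relation.Binary.PropositionalEquality

-- Binomial coefficients

module Completions where
  open import Data.Nat.Base using (_+_; _*_; _^_; _∸_)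
  open import Data.Nat.Combinatorics using (nCk≡nC[n∸k]; nCk+nC[k+1]≡[n+1]C[k+1]; k>n⇒nCk≡0)
  import Data.Nat.Tactic.RingSolver as ℕ-Solver
  open ≡-Reasoning

  absorption : ∀ n k → suc k * (suc n C suc k) ≡ suc n * (n C k)
  absorption zero zero = refl
  absorption zero (suc k) = ℕ.*-zeroʳ (suc (suc k))
  absorption (suc n) zero = begin
    1 * (suc (suc n) C 1)             ≡⟨ cong (1 *_) (sym (nCk+nC[k+1]≡[n+1]C[k+1] (suc n) 0)) ⟩
    1 * (1 + (suc n C 1))           ≡⟨ ℕ.*-distribˡ-+ 1 1 (suc n C 1) ⟩
    1 + 1 * (suc n C 1)             ≡⟨ cong (1 +_) (absorption n 0) ⟩
    1 + suc n * 1                   ∎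
  absorption (suc n) (suc k) = begin
    suc (suc k) * (suc (suc n) C suc (suc k))
      ≡⟨ cong (suc (suc k) *_) (sym (nCk+nC[k+1]≡[n+1]C[k+1] (suc n) (suc k))) ⟩
    suc (suc k) * (a + b)
      ≡⟨ lem k a b ⟩
    a + (suc k * a + suc (suc k) * b)
      ≡⟨ cong₂ (λ s t → a + (s + t)) (absorption n k) (absorption n (suc k)) ⟩
    a + (suc n * (n C k) + suc n * (n C suc k))
      ≡⟨ cong (a +_) (sym (ℕ.*-distribˡ-+ (suc n) (n C k) (n C suc k))) ⟩
    a + suc n * ((n C k) + (n C suc k))
      ≡⟨ cong (λ s → a + suc n * s) (nCk+nC[k+1]≡[n+1]C[k+1] n k) ⟩
    suc (suc n) * (suc n C suc k) ∎
    where
    a = suc n C suc k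
    b = suc n C suc (suc k)
    lem : ∀ k a b → suc (suc k) * (a + b) ≡ a + (suc k * a + suc (suc k) * b)
    lem = ℕ-Solver.solve-∀

  central : ℕ → ℕ
  central k = (2 * k) C k

  2*suc : ∀ k → 2 * suc k ≡ suc (suc (2 * k))
  2*suc = ℕ-Solver.solve-∀

  -- Absorption is used twice, with C(2k+1,k) = C(2k+1,k+1) in between. The right side keeps k
  -- C(2k,k) and C(2k,k) apart because it will be read as a differential equation for the series.
  central-suc : ∀ k → suc k * central (suc k) ≡ 4 * (k * central k) + 2 * central k
  central-suc k = begin
    suc k * central (suc k)                  ≡⟨ cong (λ n → suc k * (n C suc k)) (2*suc k) ⟩
    suc k * (suc (suc (2 * k)) C suc k)    ≡⟨ absorption (suc (2 * k)) k ⟩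
    suc (suc (2 * k)) * (suc (2 * k) C k)
      ≡⟨ cong (suc (suc (2 * k)) *_) (nCk≡nC[n∸k] (ℕ.m≤n⇒m≤1+n (ℕ.m≤n*m k 2))) ⟩
    suc (suc (2 * k)) * (suc (2 * k) C (suc (2 * k) ∸ k))
      ≡⟨ cong (λ m → suc (suc (2 * k)) * (suc (2 * k) C m)) (trans (cong (_∸ k) (half k)) (ℕ.m+n∸n≡m (suc k) k)) ⟩
    suc (suc (2 * k)) * (suc (2 * k) C suc k)
      ≡⟨ lem₁ k (suc (2 * k) C suc k) ⟩
    2 * (suc k * (suc (2 * k) C suc k))
      ≡⟨ cong (2 *_) (absorption (2 * k) k) ⟩
    2 * (suc (2 * k) * central k)
      ≡⟨ lem₂ k (central k) ⟩
    4 * (k * central k) + 2 * central k ∎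
    where
    half : ∀ k → suc (2 * k) ≡ suc k + k
    half = ℕ-Solver.solve-∀
    lem₁ : ∀ k a → suc (suc (2 * k)) * a ≡ 2 * (suc k * a)
    lem₁ = ℕ-Solver.solve-∀
    lem₂ : ∀ k c → 2 * (suc (2 * k) * c) ≡ 4 * (k * c) + 2 * c
    lem₂ = ℕ-Solver.solve-∀

  -- The number of ways to finish a triangular permutation when p unread values are below and q
  -- are above the largest source read so far (see Valid and enumerate-valid).
  completions : ℕ → ℕ → ℕ
  completions zero    zero          = 1
  completions (suc p) zero          = 2 ^ p
  completions zero    (suc zero)    = 1
  completions (suc p) (suc zero)    = completions p 1 + completions (suc p) 0
  completions zero    (suc (suc q)) = completions 1 (suc q)
  completions (suc p) (suc (suc q)) = completions p (suc (suc q)) + completions (suc (suc p)) (suc q)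

  Csum : ℕ → ℕ → ℕ → ℕ
  Csum n k zero    = 0
  Csum n k (suc l) = Csum n k l + (n C (k + l))

  Csum-pascal : ∀ n k l → Csum (suc n) (suc k) l ≡ Csum n k l + Csum n (suc k) l
  Csum-pascal n k zero    = refl
  Csum-pascal n k (suc l) = begin
    Csum (suc n) (suc k) l + (suc n C suc (k + l))
      ≡⟨ cong₂ _+_ (Csum-pascal n k l) (sym (nCk+nC[k+1]≡[n+1]C[k+1] n (k + l))) ⟩
    Csum n k l + Csum n (suc k) l + ((n C (k + l)) + (n C suc (k + l)))
      ≡⟨ lem (Csum n k l) (Csum n (suc k) l) (n C (k + l)) (n C suc (k + l)) ⟩
    Csum n k (suc l) + Csum n (suc k) (suc l) ∎
    where
    lem : ∀ a b c d → a + b + (c + d) ≡ a + c + (b + d)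
    lem = ℕ-Solver.solve-∀

  completions-1 : ∀ p → completions p 1 ≡ 2 ^ p
  completions-1 zero    = refl
  completions-1 (suc p) = trans (cong (_+ 2 ^ p) (completions-1 p)) (lem (2 ^ p))
    where
    lem : ∀ a → a + a ≡ 2 * a
    lem = ℕ-Solver.solve-∀

  Csum-row : ∀ n → Csum n 0 (suc n) ≡ 2 ^ n
  Csum-row zero    = refl
  Csum-row (suc n) = begin
    Csum (suc n) 0 (suc (suc n))                   ≡⟨ Csum-front (suc n) (suc n) ⟩
    1 + Csum (suc n) 1 (suc n)                   ≡⟨ cong (1 +_) (Csum-pascal n 0 (suc n)) ⟩
    1 + (Csum n 0 (suc n) + Csum n 1 (suc n))  ≡⟨ lem (Csum n 0 (suc n)) (Csum n 1 (suc n)) ⟩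
    Csum n 0 (suc n) + (1 + Csum n 1 (suc n))  ≡⟨ cong (Csum n 0 (suc n) +_) (sym (Csum-front n (suc n))) ⟩
    Csum n 0 (suc n) + (Csum n 0 (suc n) + (n C suc n)) ≡⟨ cong₂ (λ s t → s + (s + t)) (Csum-row n) (k>n⇒nCk≡0 (ℕ.n<1+n n)) ⟩
    2 ^ suc n ∎
    where
    lem : ∀ a b → 1 + (a + b) ≡ a + (1 + b)
    lem = ℕ-Solver.solve-∀
    Csum-front : ∀ n l → Csum n 0 (suc l) ≡ 1 + Csum n 1 l
    Csum-front n zero    = refl
    Csum-front n (suc l) = cong (_+ (n C suc l)) (Csum-front n l)

  -- The row q = 0 is the row sum 2^p. In the inductive step the last binomial of the sum for
  -- (p+2,q) is the one that the sum for (p,q+1) lacks. Moving it over leaves two runs of p + 2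
  -- binomials, which Pascal's rule adds term by term.
  completions-binomial : ∀ p q → completions p (suc q) ≡ Csum (p + 2 * q) q (suc p)
  completions-binomial p zero = trans (completions-1 p) (trans (sym (Csum-row p)) (cong (λ n → Csum n 0 (suc p)) (sym (ℕ.+-identityʳ p))))
  completions-binomial zero (suc q) = begin
    completions 1 (suc q)                                     ≡⟨ completions-binomial 1 q ⟩
    (n C (q + 0)) + (n C (q + 1))                       ≡⟨ cong₂ (λ s t → (n C s) + (n C t)) (ℕ.+-identityʳ q) (ℕ.+-comm q 1) ⟩
    (n C q) + (n C suc q)                                   ≡⟨ nCk+nC[k+1]≡[n+1]C[k+1] n q ⟩
    suc n C suc q                                             ≡⟨ cong₂ _C_ (sym (2*suc q)) (cong suc (sym (ℕ.+-identityʳ q))) ⟩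
    (2 * suc q) C (suc q + 0)                             ∎
    where
    n = suc (2 * q)
  completions-binomial (suc p) (suc q) = begin
    completions p (suc (suc q)) + completions (suc (suc p)) (suc q)
      ≡⟨ cong₂ _+_ (completions-binomial p (suc q)) (completions-binomial (suc (suc p)) q) ⟩
    Csum (p + 2 * suc q) (suc q) (suc p) + Csum (2 + p + 2 * q) q (3 + p)
      ≡⟨ cong (λ n → Csum n (suc q) (suc p) + Csum (2 + p + 2 * q) q (3 + p)) (eq p q) ⟩
    Csum N (suc q) (suc p) + (Csum N q (2 + p) + (N C (q + (2 + p))))
      ≡⟨ cong (λ k → Csum N (suc q) (suc p) + (Csum N q (2 + p) + (N C k))) (ℕ.+-suc q (suc p)) ⟩
    Csum N (suc q) (suc p) + (Csum N q (2 + p) + (N C (suc q + suc p)))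
      ≡⟨ lem (Csum N (suc q) (suc p)) (Csum N q (2 + p)) _ ⟩
    Csum N q (2 + p) + Csum N (suc q) (2 + p)
      ≡⟨ sym (Csum-pascal N q (2 + p)) ⟩
    Csum (suc N) (suc q) (2 + p)
      ≡⟨ cong (λ n → Csum (suc n) (suc q) (2 + p)) (sym (eq p q)) ⟩
    Csum (suc p + 2 * suc q) (suc q) (2 + p) ∎
    where
    N = 2 + p + 2 * q
    eq : ∀ p q → p + 2 * suc q ≡ 2 + p + 2 * q
    eq = ℕ-Solver.solve-∀
    lem : ∀ a b c → a + (b + c) ≡ b + (a + c)
    lem = ℕ-Solver.solve-∀

  completions-central : ∀ n → completions 0 (suc n) ≡ central n
  completions-central n = trans (completions-binomial 0 n) (cong ((2 * n) C_) (ℕ.+-identityʳ n))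

open Completions using (central; central-suc; completions; completions-central)

-- The generating function

module InverseSquareRoot where
  open import Data.Integer.Base using (ℤ; +_; -_; _+_; _*_)
  import Data.Integer.Properties as ℤ
  import Data.Integer.Tactic.RingSolver as ℤ-Solver
  open ≡-Reasoning

  module ℤ⟦x⟧ = PowerSeries ℤ.+-*-commutativeRing
  -- The outer index of an `FPS` is the exponent of v, so v is adjoined last and a row `F i` is a
  -- series in x. The carrier is then `FPS` itself.
  module ℤ⟦x,v⟧ = PowerSeries ℤ⟦x⟧.commutativeRing
  module F = CommutativeRing ℤ⟦x,v⟧.commutativeRing
  open ℤ⟦x⟧ using (conv)

  sumTo-cong : ∀ {f g} n → (∀ k → f k ≡ g k) → sumTo n f ≡ sumTo n g
  sumTo-cong zero    p = p 0
  sumTo-cong (suc n) p = cong₂ _+_ (sumTo-cong n p) (p (suc n))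

  sumTo-suc : ∀ n f → sumTo (suc n) f ≡ f 0 + sumTo n (f ∘ suc)
  sumTo-suc zero    f = refl
  sumTo-suc (suc n) f = trans (cong (_+ f (suc (suc n))) (sumTo-suc n f)) (ℤ.+-assoc (f 0) _ _)

  sumTo≡conv : ∀ F G n → sumTo n (λ k → F k * G (n ℕ.∸ k)) ≡ conv F G n
  sumTo≡conv F G zero    = refl
  sumTo≡conv F G (suc n) = trans (sumTo-suc n _) (cong (λ s → F 0 * G (suc n) + s) (sumTo≡conv (F ∘ suc) G n))

  ⊛≈* : ∀ F G → F ⊛ G ≈S F F.* G
  ⊛≈* F G i j = trans (sumTo-cong i λ a → sumTo≡conv (F a) (G (i ℕ.∸ a)) j) (go F i)
    where
    go : ∀ F i → sumTo i (λ a → conv (F a) (G (i ℕ.∸ a)) j) ≡ (F F.* G) i j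
    go F zero    = refl
    go F (suc i) = trans (sumTo-suc i _) (cong (λ s → conv (F 0) (G (suc i)) j + s) (go (F ∘ suc) i))

  -- Multiplication by v^p x^q. Exponents and indices are counted down together, so single
  -- coefficients compute and the boundary cases of the identities below become `refl`.
  shift : ℕ → ℕ → FPS → FPS
  shift zero    zero    F i       j       = F i j
  shift zero    (suc q) F i       zero    = + 0
  shift zero    (suc q) F i       (suc j) = shift zero q F i j
  shift (suc p) q       F zero    j       = + 0
  shift (suc p) q       F (suc i) j       = shift p q F i j

  conv-const : ∀ F G → (∀ k → F (suc k) ≡ + 0) → ∀ n → conv F G n ≡ F 0 * G n
  conv-const F G z zero    = refl
  conv-const F G z (suc n) = trans (cong (λ s → F 0 * G (suc n) + s) (ℤ⟦x⟧.conv-zeroˡ G z n)) (ℤ.+-identityʳ _)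

  mono-* : ∀ c p q F i j → (mono c p q F.* F) i j ≡ c * shift p q F i j
  mono-* c (suc p) q F zero j = trans (ℤ⟦x⟧.conv-zeroˡ (F 0) (λ _ → refl) j) (sym (ℤ.*-zeroʳ c))
  mono-* c (suc p) q F (suc i) j = trans (cong₂ _+_ (ℤ⟦x⟧.conv-zeroˡ (F (suc i)) (λ _ → refl) j) (mono-* c p q F i j)) (ℤ.+-identityˡ _)
  mono-* c zero q F i j = trans (row i) (go q j)
    where
    row : ∀ i → (mono c zero q F.* F) i j ≡ conv (mono c zero q 0) (F i) j
    row zero    = refl
    row (suc i) = trans (cong (λ s → conv (mono c zero q 0) (F (suc i)) j + s) (ℤ⟦x,v⟧.conv-zeroˡ F (λ _ _ → refl) i j)) (ℤ.+-identityʳ _)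
    go : ∀ q j → conv (mono c zero q 0) (F i) j ≡ c * shift zero q F i j
    go zero    j       = conv-const _ (F i) (λ _ → refl) j
    go (suc q) zero    = sym (ℤ.*-zeroʳ c)
    go (suc q) (suc j) = trans (ℤ.+-identityˡ _) (go q j)

  oneS≈1# : oneS ≈S F.1#
  oneS≈1# zero    zero    = refl
  oneS≈1# zero    (suc j) = refl
  oneS≈1# (suc i) j       = refl

  -- The coefficients of 1/√(1 - 4x).
  b : ℕ → ℤ
  b k = + central k

  -- The operator x d/dx.
  weighted : (ℕ → ℤ) → ℕ → ℤ
  weighted f k = + k * f k

  leibniz : ∀ f g n → conv (weighted f) g n + conv f (weighted g) n ≡ + n * conv f g n
  leibniz f g zero = lem (f 0) (g 0)
    where
    lem : ∀ x y → (+ 0 * x) * y + x * (+ 0 * y) ≡ + 0 * (x * y)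
    lem = ℤ-Solver.solve-∀
  leibniz f g (suc n) = begin
    (+ 0 * f 0) * g (suc n) + conv (weighted f ∘ suc) g n + (f 0 * (+ suc n * g (suc n)) + conv (f ∘ suc) (weighted g) n)
      ≡⟨ cong (λ s → (+ 0 * f 0) * g (suc n) + s + (f 0 * (+ suc n * g (suc n)) + conv (f ∘ suc) (weighted g) n)) split ⟩
    (+ 0 * f 0) * g (suc n) + (conv (f ∘ suc) g n + conv (weighted (f ∘ suc)) g n) + (f 0 * (+ suc n * g (suc n)) + conv (f ∘ suc) (weighted g) n)
      ≡⟨ lem₁ (f 0) (g (suc n)) (+ suc n) (conv (f ∘ suc) g n) _ _ ⟩
    + suc n * (f 0 * g (suc n)) + conv (f ∘ suc) g n + (conv (weighted (f ∘ suc)) g n + conv (f ∘ suc) (weighted g) n)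
      ≡⟨ cong (λ s → + suc n * (f 0 * g (suc n)) + conv (f ∘ suc) g n + s) (leibniz (f ∘ suc) g n) ⟩
    + suc n * (f 0 * g (suc n)) + conv (f ∘ suc) g n + + n * conv (f ∘ suc) g n
      ≡⟨ lem₂ (f 0 * g (suc n)) (+ n) (conv (f ∘ suc) g n) ⟩
    + suc n * (f 0 * g (suc n) + conv (f ∘ suc) g n) ∎
    where
    split : conv (weighted f ∘ suc) g n ≡ conv (f ∘ suc) g n + conv (weighted (f ∘ suc)) g n
    split = trans (ℤ⟦x⟧.conv-cong {G = g} (λ k → ℤ.suc-* (+ k) (f (suc k))) (λ _ → refl) n)
                  (ℤ⟦x⟧.conv-distribʳ g (f ∘ suc) (weighted (f ∘ suc)) n)
    lem₁ : ∀ x y m c w w′ → (+ 0 * x) * y + (c + w) + (x * (m * y) + w′) ≡ m * (x * y) + c + (w + w′)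
    lem₁ = ℤ-Solver.solve-∀
    lem₂ : ∀ x n c → (+ 1 + n) * x + c + n * c ≡ (+ 1 + n) * (x + c)
    lem₂ = ℤ-Solver.solve-∀

  -- With θ = x d/dx, `central-suc` reads θb = x(4θb + 2b), and the Leibniz rule gives θ(b²) = 2bθb.
  -- In degree n + 1 this yields (n+1)[b²]ₙ₊₁ = 4n[b²]ₙ + 4[b²]ₙ, and n + 1 cancels.
  b*b-suc : ∀ n → conv b b (suc n) ≡ + 4 * conv b b n
  b*b-suc n = ℤ.*-cancelˡ-≡ (+ suc n) _ _ (begin
    + suc n * conv b b (suc n)                 ≡⟨ twice (suc n) ⟨
    + 2 * conv (weighted b) b (suc n)          ≡⟨ cong (+ 2 *_) step ⟩
    + 2 * (+ 4 * conv (weighted b) b n + + 2 * conv b b n) ≡⟨ lem₁ (conv (weighted b) b n) (conv b b n) ⟩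
    + 4 * (+ 2 * conv (weighted b) b n) + + 4 * conv b b n ≡⟨ cong (λ s → + 4 * s + + 4 * conv b b n) (twice n) ⟩
    + 4 * (+ n * conv b b n) + + 4 * conv b b n ≡⟨ lem₂ (+ n) (conv b b n) ⟩
    + suc n * (+ 4 * conv b b n) ∎)
    where
    twice : ∀ n → + 2 * conv (weighted b) b n ≡ + n * conv b b n
    twice n = begin
      + 2 * conv (weighted b) b n                    ≡⟨ lem (conv (weighted b) b n) ⟩
      conv (weighted b) b n + conv (weighted b) b n  ≡⟨ cong (λ s → conv (weighted b) b n + s) (ℤ⟦x⟧.conv-comm (weighted b) b n) ⟩
      conv (weighted b) b n + conv b (weighted b) n  ≡⟨ leibniz b b n ⟩
      + n * conv b b n ∎
      where
      lem : ∀ x → + 2 * x ≡ x + x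
      lem = ℤ-Solver.solve-∀
    coeff : ∀ k → weighted b (suc k) ≡ + 4 * weighted b k + + 2 * b k
    coeff k = begin
      + suc k * b (suc k)                     ≡⟨ ℤ.pos-* (suc k) (central (suc k)) ⟨
      + (suc k ℕ.* central (suc k))           ≡⟨ cong +_ (central-suc k) ⟩
      + (4 ℕ.* (k ℕ.* central k)) + + (2 ℕ.* central k)
        ≡⟨ cong₂ _+_ (trans (ℤ.pos-* 4 (k ℕ.* central k)) (cong (+ 4 *_) (ℤ.pos-* k (central k)))) (ℤ.pos-* 2 (central k)) ⟩
      + 4 * weighted b k + + 2 * b k ∎
    step : conv (weighted b) b (suc n) ≡ + 4 * conv (weighted b) b n + + 2 * conv b b n
    step = begin
      + 0 * b 0 * b (suc n) + conv (weighted b ∘ suc) b n  ≡⟨ ℤ.+-identityˡ _ ⟩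
      conv (weighted b ∘ suc) b n  ≡⟨ ℤ⟦x⟧.conv-cong {G = b} coeff (λ _ → refl) n ⟩
      conv (λ k → + 4 * weighted b k + + 2 * b k) b n ≡⟨ ℤ⟦x⟧.conv-distribʳ b (λ k → + 4 * weighted b k) (λ k → + 2 * b k) n ⟩
      conv (λ k → + 4 * weighted b k) b n + conv (λ k → + 2 * b k) b n
        ≡⟨ cong₂ _+_ (ℤ⟦x⟧.conv-scale (+ 4) (weighted b) b n) (ℤ⟦x⟧.conv-scale (+ 2) b b n) ⟩
      + 4 * conv (weighted b) b n + + 2 * conv b b n ∎
    lem₁ : ∀ w a → + 2 * (+ 4 * w + + 2 * a) ≡ + 4 * (+ 2 * w) + + 4 * a
    lem₁ = ℤ-Solver.solve-∀
    lem₂ : ∀ n a → + 4 * (n * a) + + 4 * a ≡ (+ 1 + n) * (+ 4 * a)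
    lem₂ = ℤ-Solver.solve-∀

  B : FPS
  B zero    = b
  B (suc _) = λ _ → + 0

  B*B*K≈1 : oneMinus4x F.* (B F.* B) ≈S F.1#
  B*B*K≈1 i j = trans (ℤ⟦x,v⟧.conv-distribʳ (B F.* B) oneS (mono (- + 4) 0 1) i j)
                    (trans (cong₂ _+_ (mono-* (+ 1) 0 0 (B F.* B) i j) (mono-* (- + 4) 0 1 (B F.* B) i j)) (go i j))
    where
    rows : ∀ i j → (B F.* B) (suc i) j ≡ + 0
    rows i j = trans (cong₂ _+_ (trans (ℤ⟦x⟧.conv-comm b (λ _ → + 0) j) (ℤ⟦x⟧.conv-zeroˡ b (λ _ → refl) j))
                       (ℤ⟦x,v⟧.conv-zeroˡ B (λ _ _ → refl) i j)) refl
    lem : ∀ x → + 1 * (+ 4 * x) + - + 4 * x ≡ + 0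
    lem = ℤ-Solver.solve-∀
    go : ∀ i j → + 1 * (B F.* B) i j + - + 4 * shift 0 1 (B F.* B) i j ≡ F.1# i j
    go zero    zero    = refl
    go zero    (suc j) = trans (cong (λ s → + 1 * s + - + 4 * conv b b j) (b*b-suc j)) (lem (conv b b j))
    go (suc i) zero    = cong (λ s → + 1 * s + + 0) (rows i 0)
    go (suc i) (suc j) = cong₂ (λ s t → + 1 * s + - + 4 * t) (rows i (suc j)) (rows i j)

module GeneratingFunction where
  open InverseSquareRoot
  open import Data.Integer.Base using (ℤ; +_; -_; _+_; _*_)
  import Data.Integer.Properties as ℤ
  import Data.Integer.Tactic.RingSolver as ℤ-Solver

  inverse-sqrt-unique : ∀ S → S 0 0 ≡ + 1 → S ⊛ S ⊛ oneMinus4x ≈S oneS → S ≈S B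
  inverse-sqrt-unique S S₀₀ S²K = λ i j → ℤ.i-j≡0⇒i≡j (S i j) (B i j) (diff i j)
    where
    open import Relation.Binary.Reasoning.Setoid F.setoid
    K = oneMinus4x
    SSK : S F.* S F.* K F.≈ F.1#
    SSK = begin
      S F.* S F.* K  ≈⟨ F.*-congʳ {K} (⊛≈* S S) ⟨
      (S ⊛ S) F.* K  ≈⟨ ⊛≈* (S ⊛ S) K ⟨
      S ⊛ S ⊛ K      ≈⟨ S²K ⟩
      oneS           ≈⟨ oneS≈1# ⟩
      F.1#           ∎
    -- Both squares are inverses of K, so S² = S² K B² = B².
    S²≈B² : S F.* S F.≈ B F.* B
    S²≈B² = begin
      S F.* S                              ≈⟨ F.*-identityʳ (S F.* S) ⟨
      S F.* S F.* F.1#                     ≈⟨ F.*-congˡ {S F.* S} B*B*K≈1 ⟨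
      S F.* S F.* (K F.* (B F.* B))        ≈⟨ F.*-assoc (S F.* S) K (B F.* B) ⟨
      S F.* S F.* K F.* (B F.* B)          ≈⟨ F.*-congʳ {B F.* B} SSK ⟩
      F.1# F.* (B F.* B)                   ≈⟨ F.*-identityˡ (B F.* B) ⟩
      B F.* B                              ∎
    product : (S F.+ B) F.* (S F.+ F.- B) F.≈ F.0#
    product = begin
      (S F.+ B) F.* (S F.+ F.- B)
        ≈⟨ F.distribˡ (S F.+ B) S (F.- B) ⟩
      (S F.+ B) F.* S F.+ (S F.+ B) F.* (F.- B)
        ≈⟨ F.+-cong (F.distribʳ S S B) (F.trans (F.sym (-‿distribʳ-* (S F.+ B) B)) (F.-‿cong (F.distribʳ B S B))) ⟩
      S F.* S F.+ B F.* S F.+ F.- (S F.* B F.+ B F.* B)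
        ≈⟨ F.+-cong (F.trans (F.+-congʳ {B F.* S} S²≈B²) (F.trans (F.+-comm (B F.* B) (B F.* S)) (F.+-congʳ {B F.* B} (F.*-comm B S)))) F.refl ⟩
      S F.* B F.+ B F.* B F.+ F.- (S F.* B F.+ B F.* B)
        ≈⟨ F.-‿inverseʳ (S F.* B F.+ B F.* B) ⟩
      F.0# ∎
      where open import Algebra.Properties.Ring F.ring using (-‿distribʳ-*)
    regular : ∀ a → (S 0 0 + + 1) * a ≡ + 0 → a ≡ + 0
    regular a eq = ℤ.*-cancelˡ-≡ (+ 2) a (+ 0) (trans (cong (λ s → (s + + 1) * a) (sym S₀₀)) eq)
    -- Cancellation is nested: 2 is regular in ℤ, hence the v-free row of S + B is regular among the
    -- series in x, hence S + B is regular among the series in both variables.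
    diff : S F.+ F.- B F.≈ F.0#
    diff = ℤ⟦x,v⟧.conv-cancel (S F.+ B)
             (ℤ⟦x⟧.conv-cancel ((S F.+ B) 0) regular) (S F.+ F.- B) product

  -- Σᵢ u (p + i) (xv)ⁱ.
  diag : (ℕ → ℤ) → ℕ → FPS
  diag u p zero    zero    = u p
  diag u p zero    (suc j) = + 0
  diag u p (suc i) zero    = + 0
  diag u p (suc i) (suc j) = diag u (suc p) i j

  -- The coefficients of (1-y)²/(1-2y). Since Σ f(p,0) yᵖ = (1-y)/(1-2y) for f(p,0) =
  -- `completions p 0`, they are the differences f(p,0) - f(p-1,0).
  geometric : ℕ → ℤ
  geometric zero          = + 1
  geometric (suc zero)    = + 0
  geometric (suc (suc k)) = + (2 ℕ.^ k)

  binomial-* : ∀ c F i j → ((oneS ⊕ mono c 1 1) F.* F) i j ≡ F i j + c * shift 1 1 F i j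
  binomial-* c F i j = trans (ℤ⟦x,v⟧.conv-distribʳ F oneS (mono c 1 1) i j)
    (cong₂ _+_ (trans (mono-* (+ 1) 0 0 F i j) (ℤ.*-identityˡ (F i j))) (mono-* c 1 1 F i j))

  1-2xv 1-xv 1-v : FPS
  1-2xv = oneS ⊕ mono (- + 2) 1 1
  1-xv  = oneS ⊕ mono (- + 1) 1 1
  1-v   = oneS ⊕ mono (- + 1) 1 0

  -- (1 - xv)² / (1 - 2xv) = 1 + Σₖ 2ᵏ (xv)ᵏ⁺².
  U : FPS
  U = diag geometric 0

  U-equation : 1-2xv F.* U ≈S 1-xv F.* 1-xv
  U-equation i j = trans (binomial-* (- + 2) U i j) (trans (go i j) (sym (binomial-* (- + 1) 1-xv i j)))
    where
    double : ∀ a → + (2 ℕ.* a) + - + 2 * + a ≡ + 0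
    double a = trans (cong (_+ - + 2 * + a) (ℤ.pos-* 2 a)) (lem (+ a))
      where
      lem : ∀ x → + 2 * x + - + 2 * x ≡ + 0
      lem = ℤ-Solver.solve-∀
    tail : ∀ p i j → diag geometric (3 ℕ.+ p) i j + - + 2 * diag geometric (2 ℕ.+ p) i j ≡ + 0
    tail p zero    zero    = double (2 ℕ.^ p)
    tail p zero    (suc j) = refl
    tail p (suc i) zero    = refl
    tail p (suc i) (suc j) = tail (suc p) i j
    go : ∀ i j → U i j + - + 2 * shift 1 1 U i j ≡ 1-xv i j + - + 1 * shift 1 1 1-xv i j
    go zero zero = refl
    go zero (suc j) = refl
    go (suc zero) zero = refl
    go (suc (suc i)) zero = refl
    go (suc zero) (suc zero) = refl
    go (suc zero) (suc (suc j)) = refl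
    go (suc (suc zero)) (suc zero) = refl
    go (suc (suc (suc i))) (suc zero) = refl
    go (suc (suc zero)) (suc (suc zero)) = refl
    go (suc (suc zero)) (suc (suc (suc j))) = refl
    go (suc (suc (suc i))) (suc (suc zero)) = refl
    go (suc (suc (suc i))) (suc (suc (suc j))) = tail 0 i j

  -- The entry at (i , j) is completions (p + i) (j - i), or 0 when j < i.
  staircase : ℕ → ℕ → ℕ → ℤ
  staircase p zero    j       = + completions p j
  staircase p (suc i) zero    = + 0
  staircase p (suc i) (suc j) = staircase (suc p) i j

  τ : FPS
  τ i zero          = + 0
  τ i (suc zero)    = + 0
  τ i (suc (suc j)) = staircase 0 i j

  x² x³ : FPS
  x² = mono (+ 1) 0 2
  x³ = mono (+ 1) 0 3

  -- Put q = j - i. For q ≥ 2 this is the recurrence. For q = 0 the left side is f(p+i,0) -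
  -- f(p+i+1,0), and for q = 1 the recurrence has f(p+i+1,0) in place of f(p+i+2,0). Both leave a
  -- difference of values f(·,0), up to sign a value of `geometric`.
  staircase-recurrence : ∀ p i j → staircase (suc p) (suc i) j + - + 1 * staircase (suc p) i j + + 1 * staircase p i j
                         ≡ diag geometric (suc p) (suc i) j + - + 1 * diag geometric (suc p) i j
  staircase-recurrence p zero zero = lem p
    where
    one : ∀ a → + 0 + - + 1 * (a + a) + + 1 * a ≡ + 0 + - + 1 * a
    one = ℤ-Solver.solve-∀
    lem : ∀ p → + 0 + - + 1 * + completions (suc p) 0 + + 1 * + completions p 0 ≡ + 0 + - + 1 * geometric (suc p)
    lem zero    = refl
    lem (suc p) = trans (cong (λ s → + 0 + - + 1 * + (2 ℕ.^ p ℕ.+ s) + + 1 * + (2 ℕ.^ p)) (ℕ.+-identityʳ (2 ℕ.^ p))) (one (+ (2 ℕ.^ p)))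
  staircase-recurrence p zero (suc zero) = trans (cong (λ s → + (2 ℕ.^ p ℕ.+ s) + - + 1 * + (completions p 1 ℕ.+ 2 ℕ.^ p) + + 1 * + completions p 1) (ℕ.+-identityʳ (2 ℕ.^ p)))
     (lem (+ (2 ℕ.^ p)) (+ completions p 1))
    where
    lem : ∀ a c → (a + a) + - + 1 * (c + a) + + 1 * c ≡ a + + 0
    lem = ℤ-Solver.solve-∀
  staircase-recurrence p zero (suc (suc j)) = lem (+ completions (suc (suc p)) (suc j)) (+ completions p (suc (suc j)))
    where
    lem : ∀ a c → a + - + 1 * (c + a) + + 1 * c ≡ + 0
    lem = ℤ-Solver.solve-∀
  staircase-recurrence p (suc i) zero = refl
  staircase-recurrence p (suc i) (suc j) = staircase-recurrence (suc p) i j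

  kernel-equation : denomE F.* τ ≈S x³ F.* B F.+ x² F.* (1-v F.* U)
  kernel-equation i j = trans lhs (trans (go i j) (sym rhs))
    where
    left right : FPS
    left  i j = τ i j + - + 1 * shift 1 0 τ i j + + 1 * shift 2 1 τ i j
    right i j = + 1 * shift 0 3 B i j + + 1 * shift 0 2 (λ i j → U i j + - + 1 * shift 1 0 U i j) i j
    lhs : (denomE F.* τ) i j ≡ left i j
    lhs = trans (ℤ⟦x,v⟧.conv-distribʳ τ (oneS ⊕ mono (- + 1) 1 0) (mono (+ 1) 2 1) i j)
            (cong₂ _+_ (trans (ℤ⟦x,v⟧.conv-distribʳ τ oneS (mono (- + 1) 1 0) i j)
                         (cong₂ _+_ (trans (mono-* (+ 1) 0 0 τ i j) (ℤ.*-identityˡ (τ i j))) (mono-* (- + 1) 1 0 τ i j)))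
              (mono-* (+ 1) 2 1 τ i j))
    [1-v]U : 1-v F.* U ≈S (λ i j → U i j + - + 1 * shift 1 0 U i j)
    [1-v]U i j = trans (ℤ⟦x,v⟧.conv-distribʳ U oneS (mono (- + 1) 1 0) i j)
      (cong₂ _+_ (trans (mono-* (+ 1) 0 0 U i j) (ℤ.*-identityˡ (U i j))) (mono-* (- + 1) 1 0 U i j))
    rhs : (x³ F.* B F.+ x² F.* (1-v F.* U)) i j ≡ right i j
    rhs = cong₂ _+_ (mono-* (+ 1) 0 3 B i j)
            (trans (F.*-congˡ {x²} [1-v]U i j) (mono-* (+ 1) 0 2 (λ i j → U i j + - + 1 * shift 1 0 U i j) i j))
    go : ∀ i j → left i j ≡ right i j
    go zero zero = refl
    go zero (suc zero) = refl
    go zero (suc (suc zero)) = refl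
    -- Among the coefficients free of v, the one of x^(j+3) is f(0,j+1): this is where the central
    -- binomial series and its factor x³ come from.
    go zero (suc (suc (suc j))) = trans (cong (λ s → + s + + 0 + + 0) (completions-central j)) (lem (b j))
      where
      lem : ∀ x → x + + 0 + + 0 ≡ + 1 * x + + 0
      lem = ℤ-Solver.solve-∀
    go (suc zero) zero = refl
    go (suc zero) (suc zero) = refl
    go (suc zero) (suc (suc zero)) = refl
    go (suc zero) (suc (suc (suc zero))) = refl
    -- With nothing below, `completions 0 (suc (suc j))` unfolds to `completions 1 (suc j)`, so the
    -- two terms cancel.
    go (suc zero) (suc (suc (suc (suc j)))) = lem (+ completions 1 (suc j))
      where
      lem : ∀ x → x + - + 1 * x + + 0 ≡ + 0
      lem = ℤ-Solver.solve-∀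
    go (suc (suc i)) zero = refl
    go (suc (suc i)) (suc zero) = refl
    go (suc (suc i)) (suc (suc zero)) = refl
    go (suc (suc i)) (suc (suc (suc j))) = trans (staircase-recurrence 0 i j)
      (lem (diag geometric 1 (suc i) j + - + 1 * diag geometric 1 i j))
      where
      lem : ∀ x → x ≡ + 0 + + 1 * x
      lem = ℤ-Solver.solve-∀

  numerA≈ : numerA F.≈ x² F.* 1-v F.* (1-xv F.* 1-xv)
  numerA≈ = begin
    x² ⊛ 1-v ⊛ 1-xv ⊛ 1-xv           ≈⟨ ⊛≈* (x² ⊛ 1-v ⊛ 1-xv) 1-xv ⟩
    (x² ⊛ 1-v ⊛ 1-xv) F.* 1-xv       ≈⟨ F.*-congʳ {1-xv} (⊛≈* (x² ⊛ 1-v) 1-xv) ⟩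
    (x² ⊛ 1-v) F.* 1-xv F.* 1-xv     ≈⟨ F.*-assoc (x² ⊛ 1-v) 1-xv 1-xv ⟩
    (x² ⊛ 1-v) F.* (1-xv F.* 1-xv)   ≈⟨ F.*-congʳ {1-xv F.* 1-xv} (⊛≈* x² 1-v) ⟩
    x² F.* 1-v F.* (1-xv F.* 1-xv)   ∎
    where open import Relation.Binary.Reasoning.Setoid F.setoid

  -- Multiplying τ by `denomD ⊛ Dinv` solves `kernel-equation` without division. In one summand the
  -- factor `1-2xv` turns U into (1-xv)²; in the other, `1-2xv F.* Dinv` is an inverse of `denomE`
  -- and therefore equals `Einv`.
  series-identity : ∀ Dinv Einv S → denomD ⊛ Dinv ≈S oneS → denomE ⊛ Einv ≈S oneS
    → S 0 0 ≡ + 1 → S ⊛ S ⊛ oneMinus4x ≈S oneS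
    → τ ≈S numerA ⊛ Dinv ⊕ mono (+ 1) 0 3 ⊛ Einv ⊛ S
  series-identity Dinv Einv S DD EE S₀₀ S²K = begin
    τ                                              ≈⟨ F.*-identityʳ τ ⟨
    τ F.* F.1#                                     ≈⟨ F.*-congˡ {τ} LED ⟨
    τ F.* (1-2xv F.* denomE F.* Dinv)              ≈⟨ solve 4 (λ t l e d → (t ⊙ ((l ⊙ e) ⊙ d)) ⊜ ((e ⊙ t) ⊙ (l ⊙ d))) F.refl τ 1-2xv denomE Dinv ⟩
    denomE F.* τ F.* (1-2xv F.* Dinv)              ≈⟨ F.*-congʳ {1-2xv F.* Dinv} kernel-equation ⟩
    (x³ F.* B F.+ x² F.* (1-v F.* U)) F.* LD       ≈⟨ F.distribʳ LD (x³ F.* B) (x² F.* (1-v F.* U)) ⟩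
    x³ F.* B F.* LD F.+ x² F.* (1-v F.* U) F.* LD  ≈⟨ F.+-comm (x³ F.* B F.* LD) _ ⟩
    x² F.* (1-v F.* U) F.* LD F.+ x³ F.* B F.* LD  ≈⟨ F.+-cong first second ⟩
    numerA ⊛ Dinv ⊕ mono (+ 1) 0 3 ⊛ Einv ⊛ S      ∎
    where
    open import Relation.Binary.Reasoning.Setoid F.setoid
    open import Algebra.Solver.CommutativeMonoid F.*-commutativeMonoid renaming (_⊕_ to _⊙_)
    LD = 1-2xv F.* Dinv
    LED : 1-2xv F.* denomE F.* Dinv F.≈ F.1#
    LED = begin
      1-2xv F.* denomE F.* Dinv     ≈⟨ F.*-congʳ {Dinv} (⊛≈* 1-2xv denomE) ⟨
      denomD F.* Dinv               ≈⟨ ⊛≈* denomD Dinv ⟨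
      denomD ⊛ Dinv                 ≈⟨ DD ⟩
      oneS                          ≈⟨ oneS≈1# ⟩
      F.1#                          ∎
    LD≈Einv : LD F.≈ Einv
    LD≈Einv = begin
      LD                                      ≈⟨ F.*-identityʳ LD ⟨
      LD F.* F.1#                             ≈⟨ F.*-congˡ {LD} (F.trans (F.sym (⊛≈* denomE Einv)) (F.trans EE oneS≈1#)) ⟨
      LD F.* (denomE F.* Einv)                ≈⟨ solve 4 (λ l d e i → ((l ⊙ d) ⊙ (e ⊙ i)) ⊜ (((l ⊙ e) ⊙ d) ⊙ i)) F.refl 1-2xv Dinv denomE Einv ⟩
      1-2xv F.* denomE F.* Dinv F.* Einv      ≈⟨ F.*-congʳ {Einv} LED ⟩
      F.1# F.* Einv                           ≈⟨ F.*-identityˡ Einv ⟩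
      Einv                                    ∎
    first : x² F.* (1-v F.* U) F.* LD F.≈ numerA ⊛ Dinv
    first = begin
      x² F.* (1-v F.* U) F.* LD                  ≈⟨ solve 5 (λ x w u l d → ((x ⊙ (w ⊙ u)) ⊙ (l ⊙ d)) ⊜ (((x ⊙ w) ⊙ (l ⊙ u)) ⊙ d)) F.refl x² 1-v U 1-2xv Dinv ⟩
      x² F.* 1-v F.* (1-2xv F.* U) F.* Dinv      ≈⟨ F.*-congʳ {Dinv} (F.*-congˡ {x² F.* 1-v} U-equation) ⟩
      x² F.* 1-v F.* (1-xv F.* 1-xv) F.* Dinv    ≈⟨ F.*-congʳ {Dinv} numerA≈ ⟨
      numerA F.* Dinv                            ≈⟨ ⊛≈* numerA Dinv ⟨
      numerA ⊛ Dinv                              ∎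
    second : x³ F.* B F.* LD F.≈ x³ ⊛ Einv ⊛ S
    second = begin
      x³ F.* B F.* LD          ≈⟨ F.*-cong (F.*-congˡ {x³} (F.sym (inverse-sqrt-unique S S₀₀ S²K))) LD≈Einv ⟩
      x³ F.* S F.* Einv        ≈⟨ solve 3 (λ x s e → ((x ⊙ s) ⊙ e) ⊜ ((x ⊙ e) ⊙ s)) F.refl x³ S Einv ⟩
      x³ F.* Einv F.* S        ≈⟨ F.*-congʳ {S} (⊛≈* x³ Einv) ⟨
      (x³ ⊛ Einv) F.* S        ≈⟨ ⊛≈* (x³ ⊛ Einv) S ⟨
      x³ ⊛ Einv ⊛ S            ∎

-- Enumerations

open import Data.Bool.Base using (Bool; true; false; T; not; _∧_; _∨_; if_then_else_)
open import Data.Bool.ListAction using (any)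
open import Data.Bool.Properties using (T-∧; T-∨; T?)
open import Data.Empty using (⊥; ⊥-elim)
open import Data.List.Base using (List; []; _∷_; _++_; _∷ʳ_; length; map; initLast; _∷ʳ′_; concatMap; filterᵇ; null; upTo; applyUpTo)
open import Data.List.Membership.Propositional using (_∈_; find; lose)
open import Data.List.Membership.Propositional.Properties
  using (∈-++⁻; ∈-++⁺ˡ; ∈-++⁺ʳ; ∈-map⁻; ∈-map⁺; ∈-∃++; ∈-insert; ∈-filter⁺; ∈-filter⁻; ∈-upTo⁺; ∈-upTo⁻; ∈-concatMap⁺; ∈-concatMap⁻)
open import Data.List.Properties
  using (∷-injectiveʳ; ∷-injectiveˡ; ++-assoc; ++-identityʳ; length-++; length-map; ∷ʳ-injective; length-upTo; map-upTo; map-∘; map-cong-local; filter-accept; filter-reject; map-applyUpTo; length-applyUpTo)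
open import Data.List.Relation.Binary.Permutation.Propositional using (_↭_; ↭-refl; ↭-sym; ↭-trans; ↭-prep; ↭-reflexive; ↭⇒↭ₛ)
open import Data.List.Relation.Binary.Permutation.Propositional.Properties using (All-resp-↭; ∈-resp-↭; ↭-length; shift; drop-mid; drop-∷)
open import Data.List.Relation.Binary.Permutation.Setoid.Properties (setoid ℕ) using (Unique-resp-↭)
open import Data.List.Relation.Unary.All as All using (All; []; _∷_)
import Data.List.Relation.Unary.All.Properties as All
open import Data.List.Relation.Unary.AllPairs as AllPairs using (AllPairs; []; _∷_)
import Data.List.Relation.Unary.AllPairs.Properties as AllPairs
open import Data.List.Relation.Unary.Any as Any using (here; there)
import Data.List.Relation.Unary.Any.Properties as Any
open import Data.List.Relation.Unary.Unique.Propositional using (Unique)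
import Data.List.Relation.Unary.Unique.Propositional.Properties as Unique
open import Data.Nat using (ℕ; _+_; _*_)
open import Data.Nat.Base using (_^_; _≤_; _<_; z≤n; s≤s; _<ᵇ_; _≡ᵇ_; _≤ᵇ_)
open import Data.Nat.Induction using (<-rec)
open import Data.Sum.Base using (_⊎_; inj₁; inj₂)
open import Data.Unit.Base using (⊤; tt)
open import Function.Bundles using (Equivalence)
open import Relation.Binary.Definitions using (tri<; tri≈; tri>)
open import Relation.Nullary using (¬_; Dec; yes; no; contradiction)

-- Each x is removed from `ys` once. The leftover `zs` is kept because it gives the bound on lengths
-- and, when the lengths agree and it must be empty, a permutation.
unique-⊆⇒↭ : ∀ {A : Set} {xs ys : List A} → Unique xs → (∀ {x} → x ∈ xs → x ∈ ys) → ∃ λ zs → ys ↭ xs ++ zs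
unique-⊆⇒↭ {ys = ys} [] _ = ys , ↭-refl
unique-⊆⇒↭ {xs = x ∷ xs} (x∉ ∷ u) sub with ∈-∃++ (sub (here refl))
... | as , bs , refl with unique-⊆⇒↭ {ys = as ++ bs} u sub′
  where
  sub′ : ∀ {y} → y ∈ xs → y ∈ as ++ bs
  sub′ y∈ with ∈-++⁻ as (sub (there y∈))
  ... | inj₁ p         = ∈-++⁺ˡ p
  ... | inj₂ (here eq) = ⊥-elim (All.lookup x∉ y∈ (sym eq))
  ... | inj₂ (there p) = ∈-++⁺ʳ as p
... | zs , p = zs , ↭-trans (shift x as bs) (↭-prep x p)

unique-⊆⇒length≤ : ∀ {A : Set} {xs ys : List A} → Unique xs → (∀ {x} → x ∈ xs → x ∈ ys) → length xs ≤ length ys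
unique-⊆⇒length≤ {xs = xs} u sub with unique-⊆⇒↭ u sub
... | zs , p = subst (length xs ≤_) (sym (trans (↭-length p) (length-++ xs))) (ℕ.m≤m+n _ _)

-- Two enumerations of one predicate have equal size by `enumeration-size`, so the filtered
-- permutations and the recursively generated words can be counted against each other through a
-- logical equivalence alone.
record Enumeration {A : Set} (P : A → Set) (n : ℕ) : Set where
  field
    elements : List A
    unique   : Unique elements
    sound    : ∀ {x} → x ∈ elements → P x
    complete : ∀ {x} → P x → x ∈ elements
    size     : length elements ≡ n

open Enumeration

module _ {A : Set} {P Q : A → Set} where

  enumeration-cong : ∀ {n} → (∀ {x} → P x → Q x) → (∀ {x} → Q x → P x) → Enumeration P n → Enumeration Q n
  enumeration-cong to from E = record
    { elements = elements E ; unique = unique E ; sound = to ∘ sound E ; complete = complete E ∘ from ; size = size E }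

  enumeration-⊎ : ∀ {m n} → (∀ {x} → P x → Q x → ⊥) → Enumeration P m → Enumeration Q n → Enumeration (λ x → P x ⊎ Q x) (m + n)
  enumeration-⊎ disjoint E F = record
    { elements = elements E ++ elements F
    ; unique   = Unique.++⁺ (unique E) (unique F) (λ (p , q) → disjoint (sound E p) (sound F q))
    ; sound    = λ x∈ → sound′ (∈-++⁻ (elements E) x∈)
    ; complete = λ { (inj₁ p) → ∈-++⁺ˡ (complete E p) ; (inj₂ q) → ∈-++⁺ʳ (elements E) (complete F q) }
    ; size     = trans (length-++ (elements E)) (cong₂ _+_ (size E) (size F)) }
    where
    sound′ : ∀ {x} → x ∈ elements E ⊎ x ∈ elements F → P x ⊎ Q x
    sound′ (inj₁ p) = inj₁ (sound E p)
    sound′ (inj₂ q) = inj₂ (sound F q)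

enumeration-size : ∀ {A : Set} {P : A → Set} {m n} → Enumeration P m → Enumeration P n → m ≡ n
enumeration-size E F = trans (sym (size E)) (trans
  (ℕ.≤-antisym (unique-⊆⇒length≤ (unique E) (complete F ∘ sound E)) (unique-⊆⇒length≤ (unique F) (complete E ∘ sound F)))
  (size F))

enumeration-∷ : ∀ {A : Set} {P : List A → Set} {n} x → Enumeration P n → Enumeration (λ w → ∃ λ v → w ≡ x ∷ v × P v) n
enumeration-∷ x E = record
  { elements = map (x ∷_) (elements E)
  ; unique   = Unique.map⁺ ∷-injectiveʳ (unique E)
  ; sound    = λ w∈ → let v , v∈ , eq = ∈-map⁻ (x ∷_) w∈ in v , eq , sound E v∈
  ; complete = λ { (v , refl , p) → ∈-map⁺ (x ∷_) (complete E p) }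
  ; size     = trans (length-map (x ∷_) (elements E)) (size E) }

-- Words whose sequence of sources has no valley

-- Valid ls hs w: after a prefix whose largest source is M, the word w uses up the unread values,
-- which are ls (below M) and hs (above M), without creating a valley in the sequence of sources.
-- Reading the smallest unread value gives a right-left minimum; any other value is a source, which
-- either exceeds M (the values of hs skipped by it then move to ls) or starts or continues the final
-- descent. The latter forces hs = [] and the value read to be the largest one left, because the last
-- entry of a permutation is at least as large as all its right-left minima.
data Valid : List ℕ → List ℕ → List ℕ → Set
data Up    : List ℕ → List ℕ → List ℕ → Set

data Valid where
  done : Valid [] [] []
  low  : ∀ {l ls hs w} → Valid ls hs w → Valid (l ∷ ls) hs (l ∷ w)
  up   : ∀ {ls hs w} → Up ls hs w → Valid ls hs w
  down : ∀ {l ls x w} → Valid (l ∷ ls) [] w → Valid (l ∷ ls ∷ʳ x) [] (x ∷ w)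

data Up where
  take : ∀ {ls h hs w} → Valid ls hs w → Up ls (h ∷ hs) (h ∷ w)
  skip : ∀ {ls h hs w} → Up (ls ∷ʳ h) hs w → Up ls (h ∷ hs) w

Sorted : List ℕ → Set
Sorted = AllPairs _<_

sorted-remove : ∀ xs {y ys} → Sorted (xs ++ y ∷ ys) → Sorted (xs ++ ys)
sorted-remove []       (_ ∷ s) = s
sorted-remove (x ∷ xs) (a ∷ s) = All.++⁺ (proj₁ (All.++⁻ xs a)) (All.tail (proj₂ (All.++⁻ xs a))) ∷ sorted-remove xs s

sorted-before : ∀ xs {y ys} → Sorted (xs ++ y ∷ ys) → All (_< y) xs
sorted-before []       s       = []
sorted-before (x ∷ xs) (a ∷ s) = All.lookup a (∈-insert xs) ∷ sorted-before xs s

sorted-after : ∀ xs {y ys} → Sorted (xs ++ y ∷ ys) → All (y <_) ys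
sorted-after []       (a ∷ _) = a
sorted-after (x ∷ xs) (_ ∷ s) = sorted-after xs s

sorted-++ : ∀ {x y} xs {ys} → Sorted (xs ++ ys) → x ∈ xs → y ∈ ys → x < y
sorted-++ (x ∷ xs) (a ∷ s) (here refl) y∈ = All.lookup a (∈-++⁺ʳ xs y∈)
sorted-++ (x ∷ xs) (a ∷ s) (there x∈)  y∈ = sorted-++ xs s x∈ y∈

sorted-assoc : ∀ ls {h hs} → Sorted (ls ++ h ∷ hs) → Sorted ((ls ∷ʳ h) ++ hs)
sorted-assoc ls = subst Sorted (sym (++-assoc ls _ _))

up-head : ∀ {ls hs w} → Up ls hs w → ∃ λ x → ∃ λ v → w ≡ x ∷ v × x ∈ hs
up-head (take _) = _ , _ , refl , here refl
up-head (skip u) with up-head u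
... | x , v , eq , x∈ = x , v , eq , there x∈

-- The number of completions whose next entry exceeds M, when p values are below and q + 1 above M.
ups : ℕ → ℕ → ℕ
ups p zero    = completions p zero
ups p (suc q) = completions (suc p) (suc q)

-- Values move between the two lists, so the recursion runs on k: reading an entry lowers it, and
-- skipping keeps it while `hs` gets shorter. Sortedness makes the unread values distinct, hence the
-- alternatives disjoint and their counts additive.
enumerate-valid : ∀ k ls hs → length ls + length hs ≡ k → Sorted (ls ++ hs) →
                  Enumeration (Valid ls hs) (completions (length ls) (length hs))
enumerate-up    : ∀ k ls h hs → length ls + length hs ≡ k → Sorted (ls ++ h ∷ hs) →
                  Enumeration (Up ls (h ∷ hs)) (ups (length ls) (length hs))

enumerate-up k ls h [] eq s =
  enumeration-cong (λ { (v , refl , p) → take p }) (λ { (take p) → _ , refl , p ; (skip ()) })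
    (enumeration-∷ h (enumerate-valid k ls [] eq (sorted-remove ls s)))
enumerate-up k ls h (g ∷ hs) eq s =
  subst (Enumeration _) count
    (enumeration-cong to from
      (enumeration-⊎ disjoint
        (enumeration-∷ h (enumerate-valid k ls (g ∷ hs) eq (sorted-remove ls s)))
        (enumerate-up k (ls ∷ʳ h) g hs eq′ (sorted-assoc ls s))))
  where
  length-∷ʳ : length (ls ∷ʳ h) ≡ suc (length ls)
  length-∷ʳ = trans (length-++ ls) (ℕ.+-comm (length ls) 1)
  eq′ : length (ls ∷ʳ h) + length hs ≡ k
  eq′ = trans (cong (_+ length hs) length-∷ʳ) (trans (sym (ℕ.+-suc (length ls) (length hs))) eq)
  step : ∀ p q → completions p (suc q) + ups (suc p) q ≡ ups p (suc q)
  step p zero    = refl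
  step p (suc q) = refl
  count : completions (length ls) (suc (length hs)) + ups (length (ls ∷ʳ h)) (length hs) ≡ completions (suc (length ls)) (suc (length hs))
  count = trans (cong (λ n → completions (length ls) (suc (length hs)) + ups n (length hs)) length-∷ʳ) (step (length ls) (length hs))
  disjoint : ∀ {w} → (∃ λ v → w ≡ h ∷ v × Valid ls (g ∷ hs) v) → Up (ls ∷ʳ h) (g ∷ hs) w → ⊥
  disjoint (v , refl , _) u with up-head u
  ... | .h , _ , refl , h∈ = ℕ.<-irrefl refl (All.lookup (sorted-after ls s) h∈)
  to : ∀ {w} → (∃ λ v → w ≡ h ∷ v × Valid ls (g ∷ hs) v) ⊎ Up (ls ∷ʳ h) (g ∷ hs) w → Up ls (h ∷ g ∷ hs) w
  to (inj₁ (v , refl , p)) = take p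
  to (inj₂ u)              = skip u
  from : ∀ {w} → Up ls (h ∷ g ∷ hs) w → (∃ λ v → w ≡ h ∷ v × Valid ls (g ∷ hs) v) ⊎ Up (ls ∷ʳ h) (g ∷ hs) w
  from (take p) = inj₁ (_ , refl , p)
  from (skip u) = inj₂ u

enumerate-valid k [] [] _ _ = record
  { elements = [] ∷ [] ; unique = [] ∷ [] ; sound = λ { (here refl) → done } ; complete = complete′ ; size = refl }
  where
  complete′ : ∀ {w} → Valid [] [] w → w ∈ [] ∷ []
  complete′ done    = here refl
  complete′ (up ())
enumerate-valid (suc k) [] (h ∷ hs) eq s =
  subst (Enumeration _) (count (length hs))
    (enumeration-cong up (λ { (up u) → u }) (enumerate-up k [] h hs (ℕ.suc-injective eq) s))
  where
  count : ∀ q → ups 0 q ≡ completions 0 (suc q)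
  count zero    = refl
  count (suc q) = refl
enumerate-valid (suc k) (l ∷ ls) (h ∷ hs) eq s@(_ ∷ s′) =
  subst (Enumeration _) (count (length ls) (length hs))
    (enumeration-cong to from
      (enumeration-⊎ disjoint
        (enumeration-∷ l (enumerate-valid k ls (h ∷ hs) (ℕ.suc-injective eq) s′))
        (enumerate-up k (l ∷ ls) h hs (trans (sym (ℕ.+-suc (length ls) (length hs))) (ℕ.suc-injective eq)) s)))
  where
  count : ∀ p q → completions p (suc q) + ups (suc p) q ≡ completions (suc p) (suc q)
  count p zero    = refl
  count p (suc q) = refl
  disjoint : ∀ {w} → (∃ λ v → w ≡ l ∷ v × Valid ls (h ∷ hs) v) → Up (l ∷ ls) (h ∷ hs) w → ⊥
  disjoint (v , refl , _) u with up-head u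
  ... | .l , _ , refl , l∈ = ℕ.<-irrefl refl (sorted-++ (l ∷ ls) s (here refl) l∈)
  to : ∀ {w} → (∃ λ v → w ≡ l ∷ v × Valid ls (h ∷ hs) v) ⊎ Up (l ∷ ls) (h ∷ hs) w → Valid (l ∷ ls) (h ∷ hs) w
  to (inj₁ (v , refl , p)) = low p
  to (inj₂ u)              = up u
  from : ∀ {w} → Valid (l ∷ ls) (h ∷ hs) w → (∃ λ v → w ≡ l ∷ v × Valid ls (h ∷ hs) v) ⊎ Up (l ∷ ls) (h ∷ hs) w
  from (low p) = inj₁ (_ , refl , p)
  from (up u)  = inj₂ u
enumerate-valid (suc k) (l ∷ ls) [] eq s@(_ ∷ s′) with initLast ls
-- The only unread value is the last entry. `down` requires another value below the one it reads, so
-- only `low` applies and the word is not counted twice.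
... | [] = enumeration-cong (λ { (v , refl , p) → low p }) from
             (enumeration-∷ l (enumerate-valid k [] [] (ℕ.suc-injective eq) s′))
  where
  ¬down : ∀ {l′ x : ℕ} (ms : List ℕ) → _≡_ {A = List ℕ} (l ∷ []) (l′ ∷ ms ∷ʳ x) → ⊥
  ¬down []      ()
  ¬down (_ ∷ _) ()
  -- The index of `down` ends in an append, which cannot be matched against `l ∷ []` directly; hence
  -- a variable list with an equation.
  from′ : ∀ {ls w} → ls ≡ l ∷ [] → Valid ls [] w → ∃ λ v → w ≡ l ∷ v × Valid [] [] v
  from′ e    (low p) with refl ← e = _ , refl , p
  from′ _    (up ())
  from′ e    (down {ls = ms} p) = ⊥-elim (¬down ms (sym e))
  from : ∀ {w} → Valid (l ∷ []) [] w → ∃ λ v → w ≡ l ∷ v × Valid [] [] v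
  from = from′ refl
... | ms ∷ʳ′ x = subst (Enumeration _) count
    (enumeration-cong to (from refl)
      (enumeration-⊎ disjoint
        (enumeration-∷ l (enumerate-valid k (ms ∷ʳ x) [] (ℕ.suc-injective eq) s′))
        (enumeration-∷ x (enumerate-valid k (l ∷ ms) [] eq′ (sorted-remove (l ∷ ms) sx)))))
  where
  sx : Sorted (l ∷ ms ++ x ∷ [])
  sx = subst Sorted (++-identityʳ (l ∷ ms ∷ʳ x)) s
  length-∷ʳ : length (ms ∷ʳ x) ≡ suc (length ms)
  length-∷ʳ = trans (length-++ ms) (ℕ.+-comm (length ms) 1)
  eq′ : suc (length ms + 0) ≡ k
  eq′ = trans (cong (_+ 0) (sym length-∷ʳ)) (ℕ.suc-injective eq)
  count : completions (length (ms ∷ʳ x)) 0 + 2 ^ length ms ≡ 2 ^ length (ms ∷ʳ x)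
  count = trans (cong (λ n → completions n 0 + 2 ^ length ms) length-∷ʳ)
    (trans (cong (2 ^ length ms +_) (sym (ℕ.+-identityʳ _))) (cong (2 ^_) (sym length-∷ʳ)))
  disjoint : ∀ {w} → (∃ λ v → w ≡ l ∷ v × Valid (ms ∷ʳ x) [] v) → (∃ λ v → w ≡ x ∷ v × Valid (l ∷ ms) [] v) → ⊥
  disjoint (_ , refl , _) (_ , e , _) = ℕ.<-irrefl (∷-injectiveˡ e) (All.head (sorted-before (l ∷ ms) sx))
  to : ∀ {w} → (∃ λ v → w ≡ l ∷ v × Valid (ms ∷ʳ x) [] v) ⊎ (∃ λ v → w ≡ x ∷ v × Valid (l ∷ ms) [] v) → Valid (l ∷ ms ∷ʳ x) [] w
  to (inj₁ (v , refl , p)) = low p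
  to (inj₂ (v , refl , p)) = down p
  from : ∀ {ls w} → ls ≡ l ∷ ms ∷ʳ x → Valid ls [] w → (∃ λ v → w ≡ l ∷ v × Valid (ms ∷ʳ x) [] v) ⊎ (∃ λ v → w ≡ x ∷ v × Valid (l ∷ ms) [] v)
  from e    (low p) with refl ← e = inj₁ (_ , refl , p)
  from _    (up ())
  from e (down {l = l′} {ls = ms′} {x = x′} p) with ∷ʳ-injective (l′ ∷ ms′) (l ∷ ms) e
  ... | refl , refl = inj₂ (_ , refl , p)

-- A function of the decision itself, so that proofs about `src` can take the decision as an
-- argument and split on it in a local lemma.
consUnless : ∀ {P : Set} → Dec P → ℕ → List ℕ → List ℕ
consUnless (yes _) x xs = xs
consUnless (no _)  x xs = x ∷ xs

-- The sources of 1 ∷ w other than its first entry.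
src : List ℕ → List ℕ
src []               = []
src (x ∷ [])         = x ∷ []
src (x ∷ w@(_ ∷ _)) = consUnless (All.all? (x ℕ.<?_) w) x (src w)

src-min : ∀ {x y w} → All (x <_) (y ∷ w) → src (x ∷ y ∷ w) ≡ src (y ∷ w)
src-min {x} {y} {w} a with All.all? (x ℕ.<?_) (y ∷ w)
... | yes _ = refl
... | no ¬a = contradiction a ¬a

src-nonmin : ∀ {x y w} → ¬ All (x <_) (y ∷ w) → src (x ∷ y ∷ w) ≡ x ∷ src (y ∷ w)
src-nonmin {x} {y} {w} ¬a with All.all? (x ℕ.<?_) (y ∷ w)
... | yes a = contradiction a ¬a
... | no _  = refl

-- The sequence a ∷ L never ascends after a descent.
NoValley : ℕ → List ℕ → Set
NoValley a []          = ⊤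
NoValley a (b ∷ [])    = ⊤
NoValley a (b ∷ c ∷ L) = (b < a → c < b) × NoValley b (c ∷ L)

noValley-tail : ∀ {a b} L → NoValley a (b ∷ L) → NoValley b L
noValley-tail []      _       = tt
noValley-tail (c ∷ L) (_ , v) = v

noValley-ascent : ∀ {a b} L → a < b → NoValley b L → NoValley a (b ∷ L)
noValley-ascent []      _   _ = tt
noValley-ascent (c ∷ L) a<b v = (λ b<a → contradiction b<a (ℕ.<-asym a<b)) , v

noValley-descent : ∀ {a b} L → b < a → NoValley a (b ∷ L) → All (_< b) L
noValley-descent []      _   _       = []
noValley-descent (c ∷ L) b<a (d , v) = d b<a ∷ All.map (λ z<c → ℕ.<-trans z<c (d b<a)) (noValley-descent L (d b<a) v)

noValley-below : ∀ {a b} L → All (_< b) L → NoValley b L → NoValley a (b ∷ L)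
noValley-below []      _         _ = tt
noValley-below (c ∷ L) (c<b ∷ _) v = (λ _ → c<b) , v

src-All : ∀ {P : ℕ → Set} w → All P w → All P (src w)
src-All []          a       = a
src-All (x ∷ [])    a       = a
src-All (x ∷ y ∷ w) (p ∷ a) with All.all? (x ℕ.<?_) (y ∷ w)
... | yes _ = src-All (y ∷ w) a
... | no  _ = p ∷ src-All (y ∷ w) a

-- The last entry is in src, and every right-left minimum is at most the last entry.
src-bound : ∀ {b} w → All (_< b) (src w) → All (_< b) w
src-bound []          a = a
src-bound (x ∷ [])    a = a
src-bound {b} (x ∷ w@(_ ∷ _)) a = step (All.all? (x ℕ.<?_) w) a (src-bound w)
  where
  step : (d : Dec (All (x <_) w)) → All (_< b) (consUnless d x (src w)) →
         (All (_< b) (src w) → All (_< b) w) → All (_< b) (x ∷ w)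
  step (yes (x<y ∷ _)) a       ih = ℕ.<-trans x<y (All.head (ih a)) ∷ ih a
  step (no _)          (p ∷ a) ih = p ∷ ih a

-- Valid words are the words without a valley

valid⇒↭ : ∀ {ls hs w} → Valid ls hs w → w ↭ ls ++ hs
up⇒↭    : ∀ {ls hs w} → Up ls hs w → w ↭ ls ++ hs
valid⇒↭ done    = ↭-refl
valid⇒↭ (low v) = ↭-prep _ (valid⇒↭ v)
valid⇒↭ (up u)  = up⇒↭ u
valid⇒↭ (down {l} {ls} {x} v) =
  ↭-trans (↭-prep x (valid⇒↭ v)) (↭-trans (↭-sym (shift x (l ∷ ls) [])) (↭-reflexive (sym (++-identityʳ (l ∷ ls ∷ʳ x)))))
up⇒↭ (take {ls} {h} {hs} v) = ↭-trans (↭-prep h (valid⇒↭ v)) (↭-sym (shift h ls hs))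
up⇒↭ (skip {ls} {h} {hs} u) = ↭-trans (up⇒↭ u) (↭-reflexive (++-assoc ls (h ∷ []) hs))

sorted-init : ∀ ls {x} → Sorted ((ls ∷ʳ x) ++ []) → Sorted (ls ++ []) × All (_< x) ls
sorted-init ls {x} s = sorted-remove ls s′ , sorted-before ls s′
  where
  s′ : Sorted (ls ++ x ∷ [])
  s′ = subst Sorted (++-identityʳ (ls ∷ʳ x)) s

-- Before the last entry, `low` adds no source, and `take` with a low value still unread adds an
-- ascent from M. After `down` everything unread is smaller than x, so no ascent can follow.
valid⇒noValley : ∀ {M ls hs w} → Valid ls hs w → Sorted (ls ++ hs) → All (_< M) ls → All (M <_) hs → NoValley M (src w)
up⇒noValley : ∀ {M ls hs w} → Up ls hs w → Sorted (ls ++ hs) → All (M <_) hs → NoValley M (src w)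

valid⇒noValley done _ _ _ = tt
valid⇒noValley (low {w = []} v) _ _ _ = tt
valid⇒noValley {M} (low {l} {w = y ∷ w} v) (a ∷ s) (_ ∷ ls<M) M<hs =
  subst (NoValley M) (sym (src-min (All-resp-↭ (↭-sym (valid⇒↭ v)) a))) (valid⇒noValley v s ls<M M<hs)
valid⇒noValley (up u) s _ M<hs = up⇒noValley u s M<hs
valid⇒noValley (down {w = []} v) _ _ _ = tt
valid⇒noValley {M} (down {l} {ls} {x} {w = y ∷ w} v) s _ _ with sorted-init (l ∷ ls) s
... | s′ , (l<x ∷ ls<x) =
  subst (NoValley M) (sym (src-nonmin λ a → ℕ.<-asym l<x (All.lookup a (∈-resp-↭ (↭-sym (valid⇒↭ v)) (here refl)))))
    (noValley-below (src (y ∷ w))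
      (src-All (y ∷ w) (All-resp-↭ (↭-sym (valid⇒↭ v)) (All.++⁺ (l<x ∷ ls<x) [])))
      (valid⇒noValley v s′ (l<x ∷ ls<x) []))

up⇒noValley (take {w = []} v) _ _ = tt
-- With nothing below, h is the smallest unread value and thus a right-left minimum, so no source is
-- added and M remains the bound.
up⇒noValley {M} (take {[]} {h} {hs} {w = y ∷ w} v) (a ∷ s) (_ ∷ M<hs) =
  subst (NoValley M) (sym (src-min (All-resp-↭ (↭-sym (valid⇒↭ v)) a))) (valid⇒noValley v s [] M<hs)
up⇒noValley {M} (take {l ∷ ls} {h} {hs} {w = y ∷ w} v) s (M<h ∷ _) =
  subst (NoValley M) (sym (src-nonmin λ a → ℕ.<-asym (All.head ls<h) (All.lookup a (∈-resp-↭ (↭-sym (valid⇒↭ v)) (here refl)))))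
    (noValley-ascent (src (y ∷ w)) M<h (valid⇒noValley v (sorted-remove (l ∷ ls) s) ls<h (sorted-after (l ∷ ls) s)))
  where ls<h = sorted-before (l ∷ ls) s
up⇒noValley (skip {ls} u) s (_ ∷ M<hs) = up⇒noValley u (sorted-assoc ls s) M<hs

skips : ∀ {ls hs w} gs → Up (ls ++ gs) hs w → Up ls (gs ++ hs) w
skips {ls} {hs} {w} []       u = subst (λ ks → Up ks hs w) (++-identityʳ ls) u
skips {ls} {hs} {w} (g ∷ gs) u = skip (skips gs (subst (λ ks → Up ks hs w) (sym (++-assoc ls (g ∷ []) gs)) u))

sorted-min : ∀ {x y w ks} → x ∷ w ↭ y ∷ ks → All (x <_) w → All (y <_) ks → x ≡ y
sorted-min p x<w y<ks with ∈-resp-↭ p (here refl) | ∈-resp-↭ (↭-sym p) (here refl)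
... | here eq  | _         = eq
... | there _  | here eq   = sym eq
... | there x∈ | there y∈  = ⊥-elim (ℕ.<-asym (All.lookup x<w y∈) (All.lookup y<ks x∈))

src-min-noValley : ∀ {M x} w → All (x <_) w → NoValley M (src (x ∷ w)) → NoValley M (src w)
src-min-noValley     []      _ _ = tt
src-min-noValley {M} (y ∷ w) a v = subst (NoValley M) (src-min a) v

Completable : List ℕ → Set
Completable w = ∀ {M} ls hs → w ↭ ls ++ hs → Sorted (ls ++ hs) → All (_< M) ls → All (M <_) hs →
                NoValley M (src w) → Valid ls hs w

-- The first entry is the smallest unread value, a value above M, or a non-minimal value below M. In
-- the last case the descent from M to x makes all later sources, and by `src-bound` all later
-- entries, smaller than x; this empties `hs` and puts x at the end of `ls`.
extend-valid : ∀ {M} x w → Completable w → ∀ ls hs → x ∷ w ↭ ls ++ hs → Sorted (ls ++ hs) →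
               All (_< M) ls → All (M <_) hs → NoValley M (src (x ∷ w)) → Valid ls hs (x ∷ w)
extend-valid x w ih ls hs p s ls<M M<hs v with All.all? (x ℕ.<?_) w
extend-valid x w ih [] [] p s ls<M M<hs v | yes x<w with ↭-length p
... | ()
extend-valid x w ih [] (h ∷ hs) p (h<hs ∷ s) ls<M (_ ∷ M<hs) v | yes x<w with sorted-min p x<w h<hs
... | refl = up (take (ih [] hs (drop-∷ p) s [] M<hs (src-min-noValley w x<w v)))
extend-valid x w ih (l ∷ ls) hs p (l<ls ∷ s) (_ ∷ ls<M) M<hs v | yes x<w with sorted-min p x<w l<ls
... | refl = low (ih ls hs (drop-∷ p) s ls<M M<hs (src-min-noValley w x<w v))
extend-valid x [] ih ls hs p s ls<M M<hs v | no ¬min = contradiction [] ¬min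
extend-valid {M} x w@(y ∷ w′) ih ls hs p s ls<M M<hs v | no ¬min with ∈-++⁻ ls (∈-resp-↭ p (here refl))
... | inj₂ x∈hs with ∈-∃++ x∈hs
...   | gs , ks , refl = up (skips gs (take (ih (ls ++ gs) ks p′ (sorted-remove (ls ++ gs) s′)
          (sorted-before (ls ++ gs) s′) (sorted-after (ls ++ gs) s′) (noValley-tail (src w) (subst (NoValley M) (src-nonmin ¬min) v)))))
  where
  s′ : Sorted ((ls ++ gs) ++ x ∷ ks)
  s′ = subst Sorted (sym (++-assoc ls gs (x ∷ ks))) s
  p′ : w ↭ (ls ++ gs) ++ ks
  p′ = drop-mid [] (ls ++ gs) (↭-trans p (↭-reflexive (sym (++-assoc ls gs (x ∷ ks)))))
extend-valid {M} x w@(y ∷ w′) ih ls hs p s ls<M M<hs v | no ¬min | inj₁ x∈ls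
  with ∈-∃++ x∈ls
... | gs , ks , refl = go gs ks hs p s M<hs
  where
  x<M : x < M
  x<M = All.lookup ls<M x∈ls
  v′ : NoValley M (x ∷ src w)
  v′ = subst (NoValley M) (src-nonmin ¬min) v
  w<x : All (_< x) w
  w<x = src-bound w (noValley-descent (src w) x<M v′)
  go : ∀ gs ks hs → x ∷ w ↭ (gs ++ x ∷ ks) ++ hs → Sorted ((gs ++ x ∷ ks) ++ hs) → All (M <_) hs → Valid (gs ++ x ∷ ks) hs (x ∷ w)
  go gs ks (h ∷ hs) p s (M<h ∷ _) with ∈-resp-↭ (↭-sym p) (∈-++⁺ʳ (gs ++ x ∷ ks) (here refl))
  ... | here refl = contradiction M<h (ℕ.<-asym x<M)
  ... | there h∈w = contradiction (ℕ.<-trans x<M M<h) (ℕ.<-asym (All.lookup w<x h∈w))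
  go gs (k ∷ ks) [] p s _ with ∈-resp-↭ (↭-sym p) (∈-++⁺ˡ (∈-++⁺ʳ gs (there (here refl))))
  ... | k∈ with All.head (sorted-after gs (subst Sorted (++-identityʳ (gs ++ x ∷ k ∷ ks)) s)) | k∈
  ...   | x<k | here refl = contradiction refl (ℕ.<⇒≢ x<k)
  ...   | x<k | there k∈w = contradiction x<k (ℕ.<-asym (All.lookup w<x k∈w))
  go [] [] [] p s _ with ↭-length p
  ... | ()
  go (g ∷ gs) [] [] p s _ = down (ih (g ∷ gs) [] p′ (proj₁ (sorted-init (g ∷ gs) s)) (proj₂ (sorted-init (g ∷ gs) s)) [] (noValley-tail (src w) v′))
    where
    p′ : w ↭ (g ∷ gs) ++ []
    p′ = drop-mid [] (g ∷ gs) (↭-trans p (↭-reflexive (++-identityʳ (g ∷ gs ∷ʳ x))))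

noValley⇒valid : ∀ w → Completable w
noValley⇒valid []      []       []       p _ _ _ _ = done
noValley⇒valid []      []       (h ∷ hs) p _ _ _ _ = contradiction (↭-length p) λ ()
noValley⇒valid []      (l ∷ ls) hs       p _ _ _ _ = contradiction (↭-length p) λ ()
noValley⇒valid (x ∷ w) = extend-valid x w (noValley⇒valid w)

-- Adjacent entries of a list

-- Members of a set of positions are consecutive exactly when they are adjacent in its increasing
-- list; this turns the Boolean `consec` into something that admits induction.
data Adj {A : Set} (a b : A) : List A → Set where
  here  : ∀ {xs} → Adj a b (a ∷ b ∷ xs)
  there : ∀ {x xs} → Adj a b xs → Adj a b (x ∷ xs)

adj-∈ˡ : ∀ {A : Set} {a b : A} {xs} → Adj a b xs → a ∈ xs
adj-∈ˡ here      = here refl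
adj-∈ˡ (there p) = there (adj-∈ˡ p)

adj-∈ʳ : ∀ {A : Set} {a b : A} {xs} → Adj a b xs → b ∈ xs
adj-∈ʳ here      = there (here refl)
adj-∈ʳ (there p) = there (adj-∈ʳ p)

adj-< : ∀ {a b xs} → Sorted xs → Adj a b xs → a < b
adj-< ((a<b ∷ _) ∷ _) here      = a<b
adj-< (_ ∷ s)         (there p) = adj-< s p

adj-gap : ∀ {a b c xs} → Sorted xs → Adj a b xs → c ∈ xs → a < c → c < b → ⊥
adj-gap (_ ∷ b<xs ∷ _) here      (here refl)         a<c c<b = ℕ.<-irrefl refl a<c
adj-gap (_ ∷ b<xs ∷ _) here      (there (here refl)) a<c c<b = ℕ.<-irrefl refl c<b
adj-gap (_ ∷ b<xs ∷ _) here      (there (there c∈))  a<c c<b = ℕ.<-asym c<b (All.lookup b<xs c∈)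
adj-gap (x<xs ∷ s)     (there p) (here refl)         a<c c<b = ℕ.<-asym a<c (All.lookup x<xs (adj-∈ˡ p))
adj-gap (x<xs ∷ s)     (there p) (there c∈)          a<c c<b = adj-gap s p c∈ a<c c<b

adj-intro : ∀ {a b} xs → Sorted xs → a ∈ xs → b ∈ xs → a < b → (∀ {c} → c ∈ xs → a < c → c < b → ⊥) → Adj a b xs
adj-intro (x ∷ xs) (x<xs ∷ s) (there a∈) (here refl) a<b gap = ⊥-elim (ℕ.<-asym a<b (All.lookup x<xs a∈))
adj-intro (x ∷ xs) (x<xs ∷ s) (there a∈) (there b∈)  a<b gap = there (adj-intro xs s a∈ b∈ a<b (gap ∘ there))
adj-intro (x ∷ xs) _          (here refl) (here refl) a<b gap = ⊥-elim (ℕ.<-irrefl refl a<b)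
adj-intro (x ∷ y ∷ xs) _      (here refl) (there (here refl)) a<b gap = here
adj-intro (x ∷ y ∷ xs) ((x<y ∷ _) ∷ y<xs ∷ _) (here refl) (there (there b∈)) a<b gap =
  ⊥-elim (gap (there (here refl)) x<y (All.lookup y<xs b∈))

adj-nextUnique : ∀ {a b c xs} → Sorted xs → Adj a b xs → Adj a c xs → b ≡ c
adj-nextUnique {b = b} {c} s p q with ℕ.<-cmp b c
... | tri< b<c _ _ = ⊥-elim (adj-gap s q (adj-∈ʳ p) (adj-< s p) b<c)
... | tri≈ _ b≡c _ = b≡c
... | tri> _ _ c<b = ⊥-elim (adj-gap s p (adj-∈ʳ q) (adj-< s q) c<b)

adj-prevUnique : ∀ {a b c xs} → Sorted xs → Adj a c xs → Adj b c xs → a ≡ b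
adj-prevUnique {a} {b} s p q with ℕ.<-cmp a b
... | tri< a<b _ _ = ⊥-elim (adj-gap s p (adj-∈ˡ q) a<b (adj-< s q))
... | tri≈ _ a≡b _ = a≡b
... | tri> _ _ b<a = ⊥-elim (adj-gap s q (adj-∈ˡ p) b<a (adj-< s p))

adj-prev : ∀ {A : Set} {a v : A} L → v ∈ L → ∃ λ u → Adj u v (a ∷ L)
adj-prev (b ∷ L) (here refl) = _ , here
adj-prev (b ∷ L) (there v∈) with adj-prev L v∈
... | u , p = u , there p

-- `NoValley` sees values and the edges see positions. In a sorted list of positions j occurs once,
-- so the two adjacent pairs meet at the same place.
noValley⇒adj : ∀ (f : ℕ → ℕ) {i j k} a L → Sorted (a ∷ L) → NoValley (f a) (map f L) →
               Adj i j (a ∷ L) → Adj j k (a ∷ L) → f j < f i → f k < f j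
noValley⇒adj f a (b ∷ L) s v here q with q
... | here = ⊥-elim (ℕ.<-irrefl refl (All.head (AllPairs.head s)))
... | there here = proj₁ v
... | there (there r) = ⊥-elim (ℕ.<-irrefl refl (All.lookup (AllPairs.head (AllPairs.tail s)) (adj-∈ˡ r)))
noValley⇒adj f a (b ∷ L) s v (there p) here = ⊥-elim (ℕ.<-irrefl refl (All.lookup (AllPairs.head s) (adj-∈ʳ p)))
noValley⇒adj f a (b ∷ L) s v (there p) (there q) = noValley⇒adj f b L (AllPairs.tail s) (noValley-tail (map f L) v) p q

adj⇒noValley : ∀ (f : ℕ → ℕ) a L → (∀ {i j k} → Adj i j (a ∷ L) → Adj j k (a ∷ L) → f j < f i → f k < f j) →
               NoValley (f a) (map f L)
adj⇒noValley f a []          h = tt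
adj⇒noValley f a (b ∷ [])    h = tt
adj⇒noValley f a (b ∷ c ∷ L) h = h here (there here) , adj⇒noValley f b (c ∷ L) (λ p q → h (there p) (there q))

descent-chain : ∀ (f : ℕ → ℕ) {v} a b L → NoValley (f a) (map f (b ∷ L)) → f b < f a → v ∈ b ∷ L →
                ∃ λ u → Adj u v (a ∷ b ∷ L) × f v < f u
descent-chain f a b L       nv       b<a (here refl) = a , here , b<a
descent-chain f a b (c ∷ L) (d , nv) b<a (there v∈) with descent-chain f b c L nv (d b<a) v∈
... | u , p , v<u = u , there p , v<u

-- Excludes a second decreasing path: after one descent all steps descend, so every later source is
-- entered by a descent and cannot be a start.
later-descent : ∀ (f : ℕ → ℕ) {v w v′} a L → Sorted (a ∷ L) → NoValley (f a) (map f L) →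
                Adj v w (a ∷ L) → f w < f v → v′ ∈ a ∷ L → v < v′ → ∃ λ u → Adj u v′ (a ∷ L) × f v′ < f u
later-descent f a (b ∷ L) s nv here d (here refl) v<v′ = ⊥-elim (ℕ.<-irrefl refl v<v′)
later-descent f a (b ∷ L) s nv here d (there v′∈) v<v′ = descent-chain f a b L nv d v′∈
later-descent f a (b ∷ L) s nv (there p) d (here refl) v<v′ = ⊥-elim (ℕ.<-asym v<v′ (All.lookup (AllPairs.head s) (adj-∈ˡ p)))
later-descent f a (b ∷ L) (_ ∷ s) nv (there p) d (there v′∈) v<v′ with later-descent f b L s (noValley-tail (map f L) nv) p d v′∈ v<v′
... | u , q , lt = u , there q , lt

-- Maximal paths

module _ {A B : Set} (g : A → List B) where

  length-concatMap-≤ : ∀ {c} xs → (∀ {x} → x ∈ xs → length (g x) ≤ c) → length (concatMap g xs) ≤ length xs * c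
  length-concatMap-≤ []       _ = z≤n
  length-concatMap-≤ (x ∷ xs) h = subst (_≤ _) (sym (length-++ (g x))) (ℕ.+-mono-≤ (h (here refl)) (length-concatMap-≤ xs (h ∘ there)))

  length-concatMap-≥ : ∀ xs → (∀ x → 1 ≤ length (g x)) → length xs ≤ length (concatMap g xs)
  length-concatMap-≥ []       _ = z≤n
  length-concatMap-≥ (x ∷ xs) h = subst (_ ≤_) (sym (length-++ (g x))) (ℕ.+-mono-≤ (h x) (length-concatMap-≥ xs h))

  length-concatMap-∈ : ∀ {x} xs → x ∈ xs → length (g x) ≤ length (concatMap g xs)
  length-concatMap-∈ (x ∷ xs) (here refl) = subst (_ ≤_) (sym (length-++ (g x))) (ℕ.m≤m+n _ _)
  length-concatMap-∈ (x ∷ xs) (there x∈)  = subst (_ ≤_) (sym (length-++ (g x))) (ℕ.m≤n⇒m≤o+n _ (length-concatMap-∈ xs x∈))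

  length-concatMap-∈₂ : ∀ {x y} xs → x ∈ xs → y ∈ xs → x ≢ y → length (g x) + length (g y) ≤ length (concatMap g xs)
  length-concatMap-∈₂ (x ∷ xs) (here refl) (here refl) x≢y = ⊥-elim (x≢y refl)
  length-concatMap-∈₂ (x ∷ xs) (here refl) (there y∈)  x≢y =
    subst (_ ≤_) (sym (length-++ (g x))) (ℕ.+-monoʳ-≤ _ (length-concatMap-∈ xs y∈))
  length-concatMap-∈₂ {x} {y} (y ∷ xs) (there x∈) (here refl)  x≢y =
    subst₂ _≤_ (ℕ.+-comm (length (g y)) (length (g x))) (sym (length-++ (g y))) (ℕ.+-monoʳ-≤ _ (length-concatMap-∈ xs x∈))
  length-concatMap-∈₂ (z ∷ xs) (there x∈) (there y∈)  x≢y =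
    subst (_ ≤_) (sym (length-++ (g z))) (ℕ.m≤n⇒m≤o+n _ (length-concatMap-∈₂ xs x∈ y∈ x≢y))

length≤1 : ∀ {A : Set} {xs : List A} → Unique xs → (∀ {x y} → x ∈ xs → y ∈ xs → x ≡ y) → length xs ≤ 1
length≤1 {xs = []}     u h = z≤n
length≤1 {xs = x ∷ xs} u h = unique-⊆⇒length≤ {ys = x ∷ []} u (λ y∈ → here (h y∈ (here refl)))

<⇒≢-unique : ∀ {xs} → Sorted xs → Unique xs
<⇒≢-unique = AllPairs.map ℕ.<⇒≢

∈-posns⁺ : ∀ {n i} → 1 ≤ i → i ≤ n → i ∈ posns n
∈-posns⁺ {i = suc i} _ i<n = ∈-map⁺ suc (∈-upTo⁺ i<n)

∈-posns⁻ : ∀ {n i} → i ∈ posns n → 1 ≤ i × i ≤ n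
∈-posns⁻ i∈ with ∈-map⁻ suc i∈
... | j , j∈ , refl = s≤s z≤n , ∈-upTo⁻ j∈

posns-sorted : ∀ n → Sorted (posns n)
posns-sorted n = AllPairs.map⁺ (AllPairs.applyUpTo⁺₁ id n (λ i<j _ → s≤s i<j))

length-posns : ∀ n → length (posns n) ≡ n
length-posns n = trans (length-map suc (upTo n)) (length-upTo n)

module _ {A : Set} (p : A → Bool) where

  null-filter⁺ : ∀ xs → (∀ {x} → x ∈ xs → ¬ T (p x)) → T (null (filterᵇ p xs))
  null-filter⁺ []       h = tt
  null-filter⁺ (x ∷ xs) h with p x | h (here refl)
  ... | true  | ¬px = ⊥-elim (¬px tt)
  ... | false | _   = null-filter⁺ xs (h ∘ there)

  null-filter⁻ : ∀ xs {x} → T (null (filterᵇ p xs)) → x ∈ xs → ¬ T (p x)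
  null-filter⁻ xs {x} t x∈ px with filterᵇ p xs | ∈-filter⁺ (T? ∘ p) x∈ px
  null-filter⁻ xs () x∈ px | _ ∷ _ | _

  nonnull-filter⁺ : ∀ xs {x} → x ∈ xs → T (p x) → T (not (null (filterᵇ p xs)))
  nonnull-filter⁺ xs x∈ px with filterᵇ p xs | ∈-filter⁺ (T? ∘ p) x∈ px
  ... | _ ∷ _ | _ = tt

  nonnull-filter⁻ : ∀ xs → T (not (null (filterᵇ p xs))) → ∃ λ x → x ∈ xs × T (p x)
  nonnull-filter⁻ (x ∷ xs) t with p x in eq
  ... | true  = x , here refl , subst T (sym eq) tt
  ... | false = let y , y∈ , py = nonnull-filter⁻ xs t in y , there y∈ , py

∧⁺ : ∀ {a b} → T a → T b → T (a ∧ b)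
∧⁺ p q = Equivalence.from T-∧ (p , q)

∧⁻ : ∀ {a b} → T (a ∧ b) → T a × T b
∧⁻ = Equivalence.to T-∧

not⁺ : ∀ {a} → ¬ T a → T (not a)
not⁺ {true}  ¬t = ¬t tt
not⁺ {false} _  = tt

not⁻ : ∀ {a} → T (not a) → ¬ T a
not⁻ {false} _ ()

T-extensional : ∀ {a b} → (T a → T b) → (T b → T a) → a ≡ b
T-extensional {true}  {true}  _ _ = refl
T-extensional {true}  {false} f _ = ⊥-elim (f tt)
T-extensional {false} {true}  _ g = ⊥-elim (g tt)
T-extensional {false} {false} _ _ = refl

¬T⇒≡false : ∀ {a} → ¬ T a → a ≡ false
¬T⇒≡false {true}  ¬t = ⊥-elim (¬t tt)
¬T⇒≡false {false} _  = refl

module _ {A : Set} where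

  filterᵇ-map : ∀ {B : Set} (p : B → Bool) (f : A → B) xs → filterᵇ p (map f xs) ≡ map f (filterᵇ (p ∘ f) xs)
  filterᵇ-map p f []       = refl
  filterᵇ-map p f (x ∷ xs) with p (f x)
  ... | true  = cong (f x ∷_) (filterᵇ-map p f xs)
  ... | false = filterᵇ-map p f xs

  filterᵇ-cong : ∀ {p q : A → Bool} xs → (∀ {x} → x ∈ xs → p x ≡ q x) → filterᵇ p xs ≡ filterᵇ q xs
  filterᵇ-cong         []       h = refl
  filterᵇ-cong {p} {q} (x ∷ xs) h with p x | q x | h (here refl)
  ... | true  | .true  | refl = cong (x ∷_) (filterᵇ-cong xs (h ∘ there))
  ... | false | .false | refl = filterᵇ-cong xs (h ∘ there)

module Paths (π : List ℕ) (E : ℕ → ℕ → Bool) where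
  P : List ℕ
  P = posns (length π)

  outs : ℕ → List ℕ
  outs v = filterᵇ (E v) P

  starts : List ℕ
  starts = filterᵇ (λ v → null (filterᵇ (λ u → E u v) P) ∧ not (null (filterᵇ (E v) P))) P

  private
    prefixed : ℕ → ℕ → ℕ → List (List ℕ)
    prefixed f v u = map (v ∷_) (pathsFrom π f E u)

  -- Exhausted fuel still yields the one-vertex path, so the bound holds for every amount of fuel.
  paths-≥1 : ∀ f v → 1 ≤ length (pathsFrom π f E v)
  paths-≥1 zero    v = s≤s z≤n
  paths-≥1 (suc f) v with filterᵇ (E v) (posns (length π))
  ... | []     = s≤s z≤n
  ... | w ∷ ws = ℕ.≤-trans (subst (1 ≤_) (sym (length-map (v ∷_) (pathsFrom π f E w))) (paths-≥1 f w))
                   (length-concatMap-∈ (prefixed f v) (w ∷ ws) (here refl))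

  paths-≥ : ∀ f v → length (outs v) ≤ length (pathsFrom π (suc f) E v)
  paths-≥ f v with filterᵇ (E v) (posns (length π))
  ... | []     = z≤n
  ... | w ∷ ws = length-concatMap-≥ (prefixed f v) (w ∷ ws)
                   (λ u → subst (1 ≤_) (sym (length-map (v ∷_) (pathsFrom π f E u))) (paths-≥1 f u))

  -- The hypothesis `1 ≤ c` covers a vertex without outgoing edges, from which there is the
  -- one-vertex path.
  paths-≤ : ∀ f v {c} → length (outs v) ≤ c → 1 ≤ c →
            (∀ {u} → u ∈ outs v → length (pathsFrom π f E u) ≤ 1) → length (pathsFrom π (suc f) E v) ≤ c
  paths-≤ f v {c} l≤c 1≤c h with filterᵇ (E v) (posns (length π))
  ... | []     = 1≤c
  ... | w ∷ ws = ℕ.≤-trans (length-concatMap-≤ (prefixed f v) (w ∷ ws)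
                     (λ {u} u∈ → subst (_≤ 1) (sym (length-map (v ∷_) (pathsFrom π f E u))) (h u∈)))
                   (subst (_≤ c) (sym (ℕ.*-identityʳ _)) l≤c)

  ∈-outs⁺ : ∀ {v u} → u ∈ P → T (E v u) → u ∈ outs v
  ∈-outs⁺ {v} = ∈-filter⁺ (T? ∘ E v)

  ∈-outs⁻ : ∀ {v u} → u ∈ outs v → u ∈ P × T (E v u)
  ∈-outs⁻ {v} = ∈-filter⁻ (T? ∘ E v)

  outs-unique : ∀ v → Unique (outs v)
  outs-unique v = AllPairs.filter⁺ (T? ∘ E v) (<⇒≢-unique (posns-sorted (length π)))

  starts-unique : Unique starts
  starts-unique = AllPairs.filter⁺ (T? ∘ λ v → null (filterᵇ (λ u → E u v) P) ∧ not (null (filterᵇ (E v) P)))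
                    (<⇒≢-unique (posns-sorted (length π)))

  ∈-starts⁺ : ∀ {v w} → v ∈ P → (∀ {u} → u ∈ P → ¬ T (E u v)) → w ∈ P → T (E v w) → v ∈ starts
  ∈-starts⁺ v∈ none w∈ e = ∈-filter⁺ (T? ∘ λ v → null (filterᵇ (λ u → E u v) P) ∧ not (null (filterᵇ (E v) P))) v∈
    (∧⁺ (null-filter⁺ (λ u → E u _) P none) (nonnull-filter⁺ (E _) P w∈ e))

  ∈-starts⁻ : ∀ {v} → v ∈ starts → v ∈ P × (∀ {u} → u ∈ P → ¬ T (E u v)) × ∃ λ w → w ∈ P × T (E v w)
  ∈-starts⁻ {v} v∈ with ∈-filter⁻ (T? ∘ λ v → null (filterᵇ (λ u → E u v) P) ∧ not (null (filterᵇ (E v) P))) {xs = P} v∈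
  ... | v∈P , t = v∈P , null-filter⁻ (λ u → E u v) P (proj₁ (∧⁻ t)) , nonnull-filter⁻ (E v) P (proj₂ (∧⁻ t))

  module _ (E⇒< : ∀ {i k} → i ∈ P → k ∈ P → T (E i k) → i < k) where

    -- Walking back along incoming edges lowers the position, so it stops, and the vertex where it
    -- stops still has the edge just traversed as an outgoing one.
    exists-start : ∀ a → ∀ {b} → a ∈ P → b ∈ P → T (E a b) → ∃ (_∈ starts)
    exists-start = <-rec _ λ a rec {b} a∈ b∈ e → step a rec a∈ b∈ e (T? (null (filterᵇ (λ u → E u a) P)))
      where
      Goal : ℕ → Set
      Goal a = ∀ {b} → a ∈ P → b ∈ P → T (E a b) → ∃ (_∈ starts)
      step : ∀ a → (∀ {a′} → a′ < a → Goal a′) → ∀ {b} → a ∈ P → b ∈ P → T (E a b) →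
             Dec (T (null (filterᵇ (λ u → E u a) P))) → ∃ (_∈ starts)
      step a rec a∈ b∈ e (yes t) = a , ∈-starts⁺ a∈ (null-filter⁻ (λ u → E u a) P t) b∈ e
      step a rec a∈ b∈ e (no ¬t) with nonnull-filter⁻ (λ u → E u a) P (not⁺ ¬t)
      ... | u , u∈ , e′ = rec (E⇒< u∈ a∈ e′) u∈ a∈ e′

-- Positions of sources and right-left minima

-- Position 0 has to be excluded: there the left side would be x and the right side the default
-- value 0.
at-∷ : ∀ x w {i} → 1 ≤ i → at (x ∷ w) (suc i) ≡ at w i
at-∷ x w (s≤s _) = refl

at-∈ : ∀ w {i} → 1 ≤ i → i ≤ length w → at w i ∈ w
at-∈ (x ∷ w) {suc zero}    _ _         = here refl
at-∈ (x ∷ w) {suc (suc i)} _ (s≤s i≤)  = there (at-∈ w (s≤s z≤n) i≤)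

at-surjective : ∀ w {x} → x ∈ w → ∃ λ i → i ∈ posns (length w) × at w i ≡ x
at-surjective (x ∷ w) (here refl) = 1 , here refl , refl
at-surjective (x ∷ w) (there y∈) with at-surjective w y∈
... | i , i∈ , eq with ∈-posns⁻ i∈
... | 1≤i , i≤ = suc i , ∈-posns⁺ (s≤s z≤n) (s≤s i≤) , trans (at-∷ x w 1≤i) eq

at-injective : ∀ w {i k} → Unique w → i ∈ posns (length w) → k ∈ posns (length w) → at w i ≡ at w k → i ≡ k
at-injective w u i∈ k∈ = go w u (proj₁ (∈-posns⁻ i∈)) (proj₂ (∈-posns⁻ i∈)) (proj₁ (∈-posns⁻ k∈)) (proj₂ (∈-posns⁻ k∈))
  where
  go : ∀ w {i k} → Unique w → 1 ≤ i → i ≤ length w → 1 ≤ k → k ≤ length w → at w i ≡ at w k → i ≡ k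
  go (x ∷ w) {suc zero}    {suc zero}    u _ _ _ _ eq = refl
  go (x ∷ w) {suc zero}    {suc (suc k)} (x∉ ∷ _) _ _ _ (s≤s k≤) eq = ⊥-elim (All.lookup x∉ (at-∈ w (s≤s z≤n) k≤) eq)
  go (x ∷ w) {suc (suc i)} {suc zero}    (x∉ ∷ _) _ (s≤s i≤) _ _ eq = ⊥-elim (All.lookup x∉ (at-∈ w (s≤s z≤n) i≤) (sym eq))
  go (x ∷ w) {suc (suc i)} {suc (suc k)} (_ ∷ u) _ (s≤s i≤) _ (s≤s k≤) eq = cong suc (go w u (s≤s z≤n) i≤ (s≤s z≤n) k≤ eq)

rlMin⁻ : ∀ w {i k} → T (isRLmin w i) → k ∈ posns (length w) → i < k → ¬ at w k < at w i
rlMin⁻ w {i} {k} t k∈ i<k lt =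
  not⁻ (All.lookup (All.all⁺ (λ k → not ((i <ᵇ k) ∧ (at w k <ᵇ at w i))) (posns (length w)) t) k∈)
    (∧⁺ (ℕ.<⇒<ᵇ i<k) (ℕ.<⇒<ᵇ lt))

rlMin⁺ : ∀ w {i} → (∀ {k} → k ∈ posns (length w) → i < k → ¬ at w k < at w i) → T (isRLmin w i)
rlMin⁺ w {i} h = All.all⁻ (λ k → not ((i <ᵇ k) ∧ (at w k <ᵇ at w i)))
  (All.tabulate (λ {k} k∈ → not⁺ (λ t → h k∈ (ℕ.<ᵇ⇒< i k (proj₁ (∧⁻ t))) (ℕ.<ᵇ⇒< _ _ (proj₂ (∧⁻ t))))))

-- The condition looks only to the right, so an entry put in front does not affect it. This is why
-- `src` can be defined by recursion on the word.
rlMin-∷ : ∀ x w {i} → 1 ≤ i → isRLmin (x ∷ w) (suc i) ≡ isRLmin w i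
rlMin-∷ x w {i} 1≤i = T-extensional to from
  where
  to : T (isRLmin (x ∷ w) (suc i)) → T (isRLmin w i)
  to t = rlMin⁺ w λ {k} k∈ i<k lt → let 1≤k , k≤ = ∈-posns⁻ k∈ in
    rlMin⁻ (x ∷ w) t (∈-posns⁺ (s≤s z≤n) (s≤s k≤)) (s≤s i<k) (subst₂ _<_ (sym (at-∷ x w 1≤k)) (sym (at-∷ x w 1≤i)) lt)
  from : T (isRLmin w i) → T (isRLmin (x ∷ w) (suc i))
  from t = rlMin⁺ (x ∷ w) λ { {suc k} k∈ (s≤s i<k) lt → let 1≤k = ℕ.≤-trans 1≤i (ℕ.<⇒≤ i<k) in
    rlMin⁻ w t (∈-posns⁺ 1≤k (ℕ.≤-pred (proj₂ (∈-posns⁻ k∈)))) i<k (subst₂ _<_ (at-∷ x w 1≤k) (at-∷ x w 1≤i) lt) }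

rlMin-head⁺ : ∀ x w → All (x <_) w → T (isRLmin (x ∷ w) 1)
rlMin-head⁺ x w x<w = rlMin⁺ (x ∷ w) λ { {suc k} k∈ (s≤s 1≤k) lt →
  ℕ.<-asym (subst (_< x) (at-∷ x w 1≤k) lt) (All.lookup x<w (at-∈ w 1≤k (ℕ.≤-pred (proj₂ (∈-posns⁻ k∈))))) }

rlMin-head⁻ : ∀ x w → Unique (x ∷ w) → T (isRLmin (x ∷ w) 1) → All (x <_) w
rlMin-head⁻ x w (x∉ ∷ _) t = All.tabulate λ {y} y∈ → ℕ.≤∧≢⇒< (ℕ.≮⇒≥ (bound y∈)) (All.lookup x∉ y∈)
  where
  bound : ∀ {y} → y ∈ w → ¬ y < x
  bound y∈ y<x with at-surjective w y∈
  ... | i , i∈ , refl with ∈-posns⁻ i∈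
  ... | 1≤i , i≤ = rlMin⁻ (x ∷ w) t (∈-posns⁺ (s≤s z≤n) (s≤s i≤)) (s≤s 1≤i) (subst (_< x) (sym (at-∷ x w 1≤i)) y<x)

posns-suc : ∀ m → posns (suc m) ≡ 1 ∷ map suc (posns m)
posns-suc m = cong (λ ks → 1 ∷ map suc ks) (sym (map-upTo suc m))

-- What `isSource` of `1 ∷ w` becomes at position i + 1: the leading 1 prevents every later
-- left-right minimum, and the clause for the first position concerns that 1 only.
isSrc : List ℕ → ℕ → Bool
isSrc w i = (i ≡ᵇ length w) ∨ not (isRLmin w i)

map-at-suc : ∀ x w p → map (at (x ∷ w)) (map suc (filterᵇ p (posns (length w)))) ≡ map (at w) (filterᵇ p (posns (length w)))
map-at-suc x w p = trans (sym (map-∘ (filterᵇ p (posns (length w)))))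
  (map-cong-local (All.tabulate λ i∈ → at-∷ x w (proj₁ (∈-posns⁻ (proj₁ (∈-filter⁻ (T? ∘ p) {xs = posns (length w)} i∈))))))

-- Distinct entries matter here: `isRLmin` forbids a smaller later value, whereas `src` asks that
-- all later values be strictly larger.
src-positions : ∀ w → Unique w → map (at w) (filterᵇ (isSrc w) (posns (length w))) ≡ src w
src-positions []       _ = refl
src-positions (x ∷ []) _ = refl
src-positions (x ∷ w@(_ ∷ _)) u@(_ ∷ u′) =
  trans (cong (λ ps → map (at (x ∷ w)) (filterᵇ (isSrc (x ∷ w)) ps)) (posns-suc (length w)))
        (step (All.all? (x ℕ.<?_) w))
  where
  rest = map suc (posns (length w))
  tail : map (at (x ∷ w)) (filterᵇ (isSrc (x ∷ w)) rest) ≡ src w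
  tail = trans (cong (map (at (x ∷ w))) (trans (filterᵇ-map (isSrc (x ∷ w)) suc (posns (length w)))
           (cong (map suc) (filterᵇ-cong (posns (length w)) λ {i} i∈ → cong (λ b → (i ≡ᵇ length w) ∨ not b) (rlMin-∷ x w (proj₁ (∈-posns⁻ i∈)))))))
         (trans (map-at-suc x w (isSrc w)) (src-positions w u′))
  step : (d : Dec (All (x <_) w)) → map (at (x ∷ w)) (filterᵇ (isSrc (x ∷ w)) (1 ∷ rest)) ≡ consUnless d x (src w)
  step (yes a) = trans (cong (map (at (x ∷ w))) (filter-reject (T? ∘ isSrc (x ∷ w)) {x = 1} {xs = rest} λ t → not⁻ t (rlMin-head⁺ x w a))) tail
  step (no ¬a) = trans (cong (map (at (x ∷ w))) (filter-accept (T? ∘ isSrc (x ∷ w)) {x = 1} {xs = rest} (not⁺ (¬a ∘ rlMin-head⁻ x w u)))) (cong (x ∷_) tail)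

consec⇒adj : ∀ π s {i k} → i ∈ posns (length π) → k ∈ posns (length π) → T (consec π s i k) → Adj i k (filterᵇ s (posns (length π)))
consec⇒adj π s {i} {k} i∈ k∈ t with ∧⁻ {s i} t
... | si , t₁ with ∧⁻ {s k} t₁
... | sk , t₂ with ∧⁻ {i <ᵇ k} t₂
... | i<k , gap = adj-intro _ (AllPairs.filter⁺ (T? ∘ s) (posns-sorted (length π)))
  (∈-filter⁺ (T? ∘ s) i∈ si) (∈-filter⁺ (T? ∘ s) k∈ sk) (ℕ.<ᵇ⇒< i k i<k)
  λ {c} c∈ i<c c<k → let c∈P , sc = ∈-filter⁻ (T? ∘ s) {xs = posns (length π)} c∈ in
    not⁻ (All.lookup (All.all⁺ (λ a → not (s a ∧ (i <ᵇ a) ∧ (a <ᵇ k))) (posns (length π)) gap) c∈P)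
         (∧⁺ sc (∧⁺ (ℕ.<⇒<ᵇ i<c) (ℕ.<⇒<ᵇ c<k)))

adj⇒consec : ∀ π s {i k} → Adj i k (filterᵇ s (posns (length π))) → T (consec π s i k)
adj⇒consec π s {i} {k} p =
  ∧⁺ (proj₂ (∈-filter⁻ (T? ∘ s) {xs = posns (length π)} (adj-∈ˡ p)))
    (∧⁺ (proj₂ (∈-filter⁻ (T? ∘ s) {xs = posns (length π)} (adj-∈ʳ p)))
      (∧⁺ (ℕ.<⇒<ᵇ (adj-< sorted p))
        (All.all⁻ (λ a → not (s a ∧ (i <ᵇ a) ∧ (a <ᵇ k))) {xs = posns (length π)} (All.tabulate λ {a} a∈ → not⁺ λ t →
          let sa , t′ = ∧⁻ {s a} t ; i<a , a<k = ∧⁻ {i <ᵇ a} t′ in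
          adj-gap sorted p (∈-filter⁺ (T? ∘ s) a∈ sa) (ℕ.<ᵇ⇒< i a i<a) (ℕ.<ᵇ⇒< a k a<k)))))
  where
  sorted = AllPairs.filter⁺ (T? ∘ s) (posns-sorted (length π))

-- The faces of the consecutive-minima polygon

module Faces (w : List ℕ) (1<w : All (1 <_) w) (w-unique : Unique w) (2≤m : 2 ≤ length w) where

  π : List ℕ
  π = 1 ∷ w

  n : ℕ
  n = length π

  -- All positions, the sources, and the right-left minima.
  P Q R : List ℕ
  P = posns n
  Q = filterᵇ (isSource π) P
  R = filterᵇ (isRLmin π) P

  π-unique : Unique π
  π-unique = All.map ℕ.<⇒≢ 1<w ∷ w-unique

  P-sorted : Sorted P
  P-sorted = posns-sorted n

  Q-sorted : Sorted Q
  Q-sorted = AllPairs.filter⁺ (T? ∘ isSource π) P-sorted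

  R-sorted : Sorted R
  R-sorted = AllPairs.filter⁺ (T? ∘ isRLmin π) P-sorted

  ∈Q⁻ : ∀ {i} → i ∈ Q → i ∈ P × T (isSource π i)
  ∈Q⁻ = ∈-filter⁻ (T? ∘ isSource π) {xs = P}

  ∈R⁻ : ∀ {i} → i ∈ R → i ∈ P × T (isRLmin π i)
  ∈R⁻ = ∈-filter⁻ (T? ∘ isRLmin π) {xs = P}

  ∈Q⁺ : ∀ {i} → i ∈ P → T (isSource π i) → i ∈ Q
  ∈Q⁺ = ∈-filter⁺ (T? ∘ isSource π)

  ∈R⁺ : ∀ {i} → i ∈ P → T (isRLmin π i) → i ∈ R
  ∈R⁺ = ∈-filter⁺ (T? ∘ isRLmin π)

  1∈P : 1 ∈ P
  1∈P = here refl

  n∈P : n ∈ P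
  n∈P = ∈-posns⁺ (s≤s z≤n) ℕ.≤-refl

  1<n : 1 < n
  1<n = s≤s (ℕ.≤-trans (s≤s z≤n) 2≤m)

  ¬lrMin : ∀ {i} → i ∈ P → 1 < i → ¬ T (isLRmin π i)
  ¬lrMin {suc i} i∈ (s≤s 1≤i) t = not⁻
    (All.lookup (All.all⁺ (λ k → not ((k <ᵇ suc i) ∧ (at π k <ᵇ at π (suc i)))) P t) 1∈P)
    (∧⁺ (ℕ.<⇒<ᵇ 1≤i) (ℕ.<⇒<ᵇ (subst (1 <_) (sym (at-∷ 1 w 1≤i)) (All.lookup 1<w (at-∈ w 1≤i (ℕ.≤-pred (proj₂ (∈-posns⁻ i∈))))))))

  rlMin-1 : T (isRLmin π 1)
  rlMin-1 = rlMin-head⁺ 1 w 1<w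

  rlMin-n : T (isRLmin π n)
  rlMin-n = rlMin⁺ π λ k∈ n<k _ → ℕ.<⇒≱ n<k (proj₂ (∈-posns⁻ k∈))

  source-suc : ∀ {i} → i ∈ posns (length w) → isSource π (suc i) ≡ isSrc w i
  source-suc {zero}  i∈ = contradiction (proj₁ (∈-posns⁻ i∈)) λ ()
  source-suc {suc i} i∈ = cong₂ (λ a b → (suc i ≡ᵇ length w) ∨ (not a ∧ not b))
    (¬T⇒≡false (¬lrMin (∈-posns⁺ (s≤s z≤n) (s≤s (proj₂ (∈-posns⁻ i∈)))) (s≤s (s≤s z≤n))))
    (rlMin-∷ 1 w (s≤s z≤n))

  source⇒ : ∀ {i} → i ∈ P → 1 < i → T (isSource π i) → i ≡ n ⊎ ¬ T (isRLmin π i)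
  source⇒ {suc i} i∈ (s≤s 1≤i) t with Equivalence.to (T-∨ {i ≡ᵇ length w})
      (subst T (source-suc (∈-posns⁺ 1≤i (ℕ.≤-pred (proj₂ (∈-posns⁻ i∈))))) t)
  ... | inj₁ e = inj₁ (cong suc (ℕ.≡ᵇ⇒≡ i (length w) e))
  ... | inj₂ f = inj₂ λ r → not⁻ f (subst T (rlMin-∷ 1 w 1≤i) r)

  ¬rlMin⇒source : ∀ {i} → i ∈ P → ¬ T (isRLmin π i) → T (isSource π i)
  ¬rlMin⇒source {zero}        i∈ ¬r = contradiction (proj₁ (∈-posns⁻ i∈)) λ ()
  ¬rlMin⇒source {suc zero}    i∈ ¬r = tt
  ¬rlMin⇒source {suc (suc i)} i∈ ¬r = subst T (sym (source-suc (∈-posns⁺ (s≤s z≤n) (ℕ.≤-pred (proj₂ (∈-posns⁻ i∈))))))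
    (Equivalence.from (T-∨ {suc i ≡ᵇ length w}) (inj₂ (not⁺ (¬r ∘ subst T (sym (rlMin-∷ 1 w (s≤s z≤n)))))))

  source-n : T (isSource π n)
  source-n = Equivalence.from (T-∨ {n ≡ᵇ 1}) (inj₂ (Equivalence.from (T-∨ {n ≡ᵇ n}) (inj₁ (ℕ.≡⇒≡ᵇ n n refl))))

  ∈Q∩R : ∀ {i} → i ∈ Q → i ∈ R → i ≡ 1 ⊎ i ≡ n
  ∈Q∩R {i} i∈Q i∈R with i ℕ.≟ 1
  ... | yes i≡1 = inj₁ i≡1
  ... | no i≢1 with source⇒ (proj₁ (∈Q⁻ i∈Q)) (ℕ.≤∧≢⇒< (proj₁ (∈-posns⁻ (proj₁ (∈Q⁻ i∈Q)))) (i≢1 ∘ sym)) (proj₂ (∈Q⁻ i∈Q))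
  ...   | inj₁ i≡n = inj₂ i≡n
  ...   | inj₂ ¬r  = contradiction (proj₂ (∈R⁻ i∈R)) ¬r

  ∈Q⊎R : ∀ {i} → i ∈ P → i ∈ Q ⊎ i ∈ R
  ∈Q⊎R {i} i∈ with T? (isRLmin π i)
  ... | yes r = inj₂ (∈R⁺ i∈ r)
  ... | no ¬r = inj₁ (∈Q⁺ i∈ (¬rlMin⇒source i∈ ¬r))

  Q′ R′ : List ℕ
  Q′ = filterᵇ (isSource π) (map suc (posns (length w)))
  R′ = filterᵇ (isRLmin π) (map suc (posns (length w)))

  Q≡ : Q ≡ 1 ∷ Q′
  Q≡ = cong (filterᵇ (isSource π)) (posns-suc (length w))

  R≡ : R ≡ 1 ∷ R′
  R≡ = trans (cong (filterᵇ (isRLmin π)) (posns-suc (length w)))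
             (filter-accept (T? ∘ isRLmin π) {x = 1} {xs = map suc (posns (length w))} rlMin-1)

  to-Q′ : ∀ {i k} → Adj i k Q → Adj i k (1 ∷ Q′)
  to-Q′ {i} {k} = subst (Adj i k) Q≡

  from-Q′ : ∀ {i k} → Adj i k (1 ∷ Q′) → Adj i k Q
  from-Q′ {i} {k} = subst (Adj i k) (sym Q≡)

  at-Q′ : map (at π) Q′ ≡ src w
  at-Q′ = trans (cong (map (at π)) (trans (filterᵇ-map (isSource π) suc (posns (length w)))
                                         (cong (map suc) (filterᵇ-cong (posns (length w)) source-suc))))
            (trans (map-at-suc 1 w (isSrc w)) (src-positions w w-unique))

  at-≢ : ∀ {i k} → i ∈ P → k ∈ P → i ≢ k → at π i ≢ at π k
  at-≢ i∈ k∈ i≢k eq = i≢k (at-injective π π-unique i∈ k∈ eq)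

  adjR-increases : ∀ {i k} → Adj i k R → at π i < at π k
  adjR-increases p = ℕ.≤∧≢⇒< (ℕ.≮⇒≥ (rlMin⁻ π (proj₂ (∈R⁻ (adj-∈ˡ p))) (proj₁ (∈R⁻ (adj-∈ʳ p))) (adj-< R-sorted p)))
    (at-≢ (proj₁ (∈R⁻ (adj-∈ˡ p))) (proj₁ (∈R⁻ (adj-∈ʳ p))) (ℕ.<⇒≢ (adj-< R-sorted p)))

  edge⁻ : ∀ {i k} → i ∈ P → k ∈ P → T (isEdge π i k) → Adj i k R ⊎ Adj i k Q
  edge⁻ {i} {k} i∈ k∈ t with ∧⁻ {i <ᵇ k} t
  ... | i<k , t₁ with Equivalence.to (T-∨ {consec π (isLRmin π) i k}) t₁
  ...   | inj₁ lr = ⊥-elim (¬lrMin k∈ (ℕ.≤-<-trans (proj₁ (∈-posns⁻ i∈)) (ℕ.<ᵇ⇒< i k i<k)) (proj₁ (∧⁻ {isLRmin π k} (proj₂ (∧⁻ {isLRmin π i} lr)))))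
  ...   | inj₂ t₂ with Equivalence.to (T-∨ {consec π (isRLmin π) i k}) t₂
  ...     | inj₁ r = inj₁ (consec⇒adj π (isRLmin π) i∈ k∈ r)
  ...     | inj₂ s = inj₂ (consec⇒adj π (isSource π) i∈ k∈ s)

  edge⁺ : ∀ {i k} → Adj i k R ⊎ Adj i k Q → T (isEdge π i k)
  edge⁺ {i} {k} (inj₁ p) = ∧⁺ (ℕ.<⇒<ᵇ (adj-< R-sorted p))
    (Equivalence.from (T-∨ {consec π (isLRmin π) i k}) (inj₂ (Equivalence.from (T-∨ {consec π (isRLmin π) i k}) (inj₁ (adj⇒consec π (isRLmin π) p)))))
  edge⁺ {i} {k} (inj₂ p) = ∧⁺ (ℕ.<⇒<ᵇ (adj-< Q-sorted p))
    (Equivalence.from (T-∨ {consec π (isLRmin π) i k}) (inj₂ (Equivalence.from (T-∨ {consec π (isRLmin π) i k}) (inj₂ (adj⇒consec π (isSource π) p)))))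

  inc⁻ : ∀ {i k} → i ∈ P → k ∈ P → T (incEdge π i k) → (Adj i k R ⊎ Adj i k Q) × at π i < at π k
  inc⁻ {i} {k} i∈ k∈ t = let e , lt = ∧⁻ {isEdge π i k} t in edge⁻ i∈ k∈ e , ℕ.<ᵇ⇒< (at π i) (at π k) lt

  inc⁺ : ∀ {i k} → Adj i k R ⊎ Adj i k Q → at π i < at π k → T (incEdge π i k)
  inc⁺ p lt = ∧⁺ (edge⁺ p) (ℕ.<⇒<ᵇ lt)

  dec⁻ : ∀ {i k} → i ∈ P → k ∈ P → T (decEdge π i k) → Adj i k Q × at π k < at π i
  dec⁻ {i} {k} i∈ k∈ t with ∧⁻ {isEdge π i k} t
  ... | e , lt with edge⁻ i∈ k∈ e
  ...   | inj₁ p = contradiction (ℕ.<ᵇ⇒< (at π k) (at π i) lt) (ℕ.<-asym (adjR-increases p))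
  ...   | inj₂ p = p , ℕ.<ᵇ⇒< (at π k) (at π i) lt

  dec⁺ : ∀ {i k} → Adj i k Q → at π k < at π i → T (decEdge π i k)
  dec⁺ p lt = ∧⁺ (edge⁺ (inj₂ p)) (ℕ.<⇒<ᵇ lt)

  module IncPaths = Paths π (incEdge π)
  module DecPaths = Paths π (decEdge π)

  first-adj : ∀ {L} → n ∈ 1 ∷ L → ∃ λ c → Adj 1 c (1 ∷ L)
  first-adj (here n≡1) = ⊥-elim (ℕ.<⇒≢ 1<n (sym n≡1))
  first-adj {L = c ∷ L} (there _) = c , here

  next-R : ∃ λ r → Adj 1 r R
  next-R = let r , p = first-adj (subst (n ∈_) R≡ (∈R⁺ n∈P rlMin-n)) in r , subst (Adj 1 r) (sym R≡) p

  next-Q : ∃ λ q → Adj 1 q Q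
  next-Q = let q , p = first-adj (subst (n ∈_) Q≡ (∈Q⁺ n∈P source-n)) in q , from-Q′ p

  prev-Q : ∀ {v} → v ∈ Q → v ≢ 1 → ∃ λ u → Adj u v Q
  prev-Q {v} v∈ v≢1 with subst (v ∈_) Q≡ v∈
  ... | here v≡1  = contradiction v≡1 v≢1
  ... | there v∈′ = let u , p = adj-prev Q′ v∈′ in u , from-Q′ p

  prev-R : ∀ {v} → v ∈ R → v ≢ 1 → ∃ λ u → Adj u v R
  prev-R {v} v∈ v≢1 with subst (v ∈_) R≡ v∈
  ... | here v≡1  = contradiction v≡1 v≢1
  ... | there v∈′ = let u , p = adj-prev R′ v∈′ in u , subst (Adj u v) (sym R≡) p

  ∈P-Qˡ : ∀ {i k} → Adj i k Q → i ∈ P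
  ∈P-Qˡ p = proj₁ (∈Q⁻ (adj-∈ˡ p))

  ∈P-Qʳ : ∀ {i k} → Adj i k Q → k ∈ P
  ∈P-Qʳ p = proj₁ (∈Q⁻ (adj-∈ʳ p))

  1-minimal : ∀ {k} → k ∈ P → 1 < k → at π 1 < at π k
  1-minimal k∈ 1<k = ℕ.≤∧≢⇒< (ℕ.≮⇒≥ (rlMin⁻ π rlMin-1 k∈ 1<k)) (at-≢ 1∈P k∈ (ℕ.<⇒≢ 1<k))

  -- Position 2 < n is not the last one, so it separates 1 from any common successor.
  next-distinct : ∀ {r q} → Adj 1 r R → Adj 1 q Q → r ≢ q
  next-distinct {r} p p′ refl with ∈Q∩R (adj-∈ʳ p′) (adj-∈ʳ p)
  ... | inj₁ refl = ℕ.<-irrefl refl (adj-< R-sorted p)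
  ... | inj₂ refl with ∈Q⊎R 2∈P
    where
    2∈P : 2 ∈ P
    2∈P = ∈-posns⁺ (s≤s z≤n) 1<n
  ...   | inj₁ 2∈Q = adj-gap Q-sorted p′ 2∈Q ℕ.≤-refl (s≤s 2≤m)
  ...   | inj₂ 2∈R = adj-gap R-sorted p 2∈R ℕ.≤-refl (s≤s 2≤m)

  n-last : ∀ {k L} → Sorted L → (∀ {i} → i ∈ L → i ∈ P) → ¬ Adj n k L
  n-last s sub p = ℕ.<⇒≱ (adj-< s p) (proj₂ (∈-posns⁻ (sub (adj-∈ʳ p))))

  -- A vertex other than 1 on both paths is n, which has no successor. So all edges leaving v belong
  -- to one path, where the successor is unique.
  inc-next-unique : ∀ {v i k} → v ∈ P → v ≢ 1 → i ∈ P → k ∈ P → T (incEdge π v i) → T (incEdge π v k) → i ≡ k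
  inc-next-unique v∈ v≢1 i∈ k∈ e e′ with proj₁ (inc⁻ v∈ i∈ e) | proj₁ (inc⁻ v∈ k∈ e′)
  ... | inj₁ p | inj₁ q = adj-nextUnique R-sorted p q
  ... | inj₂ p | inj₂ q = adj-nextUnique Q-sorted p q
  ... | inj₁ p | inj₂ q with ∈Q∩R (adj-∈ˡ q) (adj-∈ˡ p)
  ...   | inj₁ v≡1  = contradiction v≡1 v≢1
  ...   | inj₂ refl = ⊥-elim (n-last R-sorted (proj₁ ∘ ∈R⁻) p)
  inc-next-unique v∈ v≢1 i∈ k∈ e e′ | inj₂ p | inj₁ q with ∈Q∩R (adj-∈ˡ p) (adj-∈ˡ q)
  ...   | inj₁ v≡1  = contradiction v≡1 v≢1
  ...   | inj₂ refl = ⊥-elim (n-last R-sorted (proj₁ ∘ ∈R⁻) q)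

  1-initial : ∀ {v} → v ∈ P → ¬ T (incEdge π v 1)
  1-initial v∈ e with proj₁ (inc⁻ v∈ 1∈P e)
  ... | inj₁ p = ℕ.<⇒≱ (adj-< R-sorted p) (proj₁ (∈-posns⁻ v∈))
  ... | inj₂ p = ℕ.<⇒≱ (adj-< Q-sorted p) (proj₁ (∈-posns⁻ v∈))

  inc-paths-≤1 : ∀ f {v} → v ∈ P → v ≢ 1 → length (pathsFrom π f (incEdge π) v) ≤ 1
  inc-paths-≤1 zero    v∈ v≢1 = s≤s z≤n
  inc-paths-≤1 (suc f) {v} v∈ v≢1 = IncPaths.paths-≤ f v
    (length≤1 (IncPaths.outs-unique v) (λ i∈ k∈ → let i∈P , e = IncPaths.∈-outs⁻ {v} i∈ ; k∈P , e′ = IncPaths.∈-outs⁻ {v} k∈ in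
      inc-next-unique v∈ v≢1 i∈P k∈P e e′))
    (s≤s z≤n)
    (λ {u} u∈ → let u∈P , e = IncPaths.∈-outs⁻ {v} u∈ in
      inc-paths-≤1 f u∈P λ { refl → 1-initial v∈ e })

  inc-paths-1 : length (pathsFrom π n (incEdge π) 1) ≤ 2
  inc-paths-1 = IncPaths.paths-≤ (length w) 1
    (unique-⊆⇒length≤ {ys = proj₁ next-R ∷ proj₁ next-Q ∷ []} (IncPaths.outs-unique 1) only)
    (s≤s z≤n)
    (λ u∈ → inc-paths-≤1 (length w) (proj₁ (IncPaths.∈-outs⁻ {1} u∈)) (ℕ.<⇒≢ (after u∈) ∘ sym))
    where
    only : ∀ {u} → u ∈ IncPaths.outs 1 → u ∈ proj₁ next-R ∷ proj₁ next-Q ∷ []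
    only u∈ with IncPaths.∈-outs⁻ {1} u∈
    ... | u∈P , e with proj₁ (inc⁻ 1∈P u∈P e)
    ...   | inj₁ p = here (adj-nextUnique R-sorted p (proj₂ next-R))
    ...   | inj₂ p = there (here (adj-nextUnique Q-sorted p (proj₂ next-Q)))
    after : ∀ {u} → u ∈ IncPaths.outs 1 → 1 < u
    after u∈ with IncPaths.∈-outs⁻ {1} u∈
    ... | u∈P , e with proj₁ (inc⁻ 1∈P u∈P e)
    ...   | inj₁ p = adj-< R-sorted p
    ...   | inj₂ p = adj-< Q-sorted p

  dec-paths-≤1 : ∀ f {v} → v ∈ P → length (pathsFrom π f (decEdge π) v) ≤ 1
  dec-paths-≤1 zero    v∈ = s≤s z≤n
  dec-paths-≤1 (suc f) {v} v∈ = DecPaths.paths-≤ f v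
    (length≤1 (DecPaths.outs-unique v) (λ i∈ k∈ → let i∈P , e = DecPaths.∈-outs⁻ {v} i∈ ; k∈P , e′ = DecPaths.∈-outs⁻ {v} k∈ in
      adj-nextUnique Q-sorted (proj₁ (dec⁻ v∈ i∈P e)) (proj₁ (dec⁻ v∈ k∈P e′))))
    (s≤s z≤n)
    (λ u∈ → dec-paths-≤1 f (proj₁ (DecPaths.∈-outs⁻ {v} u∈)))

  -- The bound is 2 + 1: increasing paths start only at 1, which has at most two outgoing edges, and
  -- by `later-descent` at most one vertex starts a decreasing path.
  noValley⇒faces≤3 : NoValley 1 (src w) → faces π ≤ 3
  noValley⇒faces≤3 nv = ℕ.+-mono-≤ inc≤2 dec≤1
    where
    nv′ : NoValley (at π 1) (map (at π) Q′)
    nv′ = subst (NoValley 1) (sym at-Q′) nv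
    sorted′ : Sorted (1 ∷ Q′)
    sorted′ = subst Sorted Q≡ Q-sorted
    no-valley : ∀ {i j k} → Adj i j Q → Adj j k Q → at π j < at π i → at π k < at π j
    no-valley p q = noValley⇒adj (at π) 1 Q′ sorted′ nv′ (to-Q′ p) (to-Q′ q)

    -- A start v other than 1 cannot lie in R, whose edges all increase. Then its source edges
    -- descend into v and ascend out of it, which is a valley.
    inc-start : ∀ {v} → v ∈ IncPaths.starts → v ≡ 1
    inc-start {v} v∈ with v ℕ.≟ 1
    ... | yes v≡1 = v≡1
    ... | no v≢1 with IncPaths.∈-starts⁻ v∈
    ...   | v∈P , none , k , k∈ , e = ⊥-elim (impossible (∈Q⊎R v∈P))
      where
      notR : ¬ v ∈ R
      notR v∈R = let u , p = prev-R v∈R v≢1 in none (proj₁ (∈R⁻ (adj-∈ˡ p))) (inc⁺ (inj₁ p) (adjR-increases p))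
      impossible : v ∈ Q ⊎ v ∈ R → ⊥
      impossible (inj₂ v∈R) = notR v∈R
      impossible (inj₁ v∈Q) with prev-Q v∈Q v≢1 | inc⁻ v∈P k∈ e
      ... | u , p | inj₁ q , _  = notR (adj-∈ˡ q)
      ... | u , p | inj₂ q , lt with ℕ.<-cmp (at π u) (at π v)
      ...   | tri< u<v _ _ = none (∈P-Qˡ p) (inc⁺ (inj₂ p) u<v)
      ...   | tri≈ _ u≡v _ = at-≢ (∈P-Qˡ p) v∈P (ℕ.<⇒≢ (adj-< Q-sorted p)) u≡v
      ...   | tri> _ _ v<u = ℕ.<-asym lt (no-valley p q v<u)

    inc≤2 : length (maximalPaths π (incEdge π)) ≤ 2
    inc≤2 = ℕ.≤-trans
      (length-concatMap-≤ (pathsFrom π n (incEdge π)) IncPaths.starts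
        (λ {v} v∈ → subst (λ u → length (pathsFrom π n (incEdge π) u) ≤ 2) (sym (inc-start v∈)) inc-paths-1))
      (ℕ.*-monoˡ-≤ 2 (length≤1 IncPaths.starts-unique (λ u∈ v∈ → trans (inc-start u∈) (sym (inc-start v∈)))))

    dec-start-< : ∀ {u v} → u ∈ DecPaths.starts → v ∈ DecPaths.starts → ¬ u < v
    dec-start-< {u} {v} u∈ v∈ u<v =
      let u∈P , _ , k , k∈ , e         = DecPaths.∈-starts⁻ u∈
          v∈P , none , k′ , k′∈ , e′   = DecPaths.∈-starts⁻ v∈
          p , d                        = dec⁻ u∈P k∈ e
          q , _                        = dec⁻ v∈P k′∈ e′
          t , r , d′                   = later-descent (at π) 1 Q′ sorted′ nv′ (to-Q′ p) d (subst (v ∈_) Q≡ (adj-∈ˡ q)) u<v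
      in none (∈P-Qˡ (from-Q′ r)) (dec⁺ (from-Q′ r) d′)

    dec-start : ∀ {u v} → u ∈ DecPaths.starts → v ∈ DecPaths.starts → u ≡ v
    dec-start {u} {v} u∈ v∈ with ℕ.<-cmp u v
    ... | tri< u<v _ _ = ⊥-elim (dec-start-< u∈ v∈ u<v)
    ... | tri≈ _ u≡v _ = u≡v
    ... | tri> _ _ v<u = ⊥-elim (dec-start-< v∈ u∈ v<u)

    dec≤1 : length (maximalPaths π (decEdge π)) ≤ 1
    dec≤1 = ℕ.≤-trans
      (length-concatMap-≤ (pathsFrom π n (decEdge π)) DecPaths.starts (λ v∈ → dec-paths-≤1 n (proj₁ (DecPaths.∈-starts⁻ v∈))))
      (ℕ.*-monoˡ-≤ 1 (length≤1 DecPaths.starts-unique dec-start))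

  -- The bound is 3 + 1: two increasing paths leave 1, another starts at the bottom j of the valley,
  -- and the descent from i to j, traced back, gives the start of a decreasing path.
  valley⇒4≤faces : ∀ {i j k} → Adj i j Q → Adj j k Q → at π j < at π i → at π j < at π k → 4 ≤ faces π
  valley⇒4≤faces {i} {j} {k} p q j<i j<k = ℕ.+-mono-≤ 3≤inc 1≤dec
    where
    1<j : 1 < j
    1<j = ℕ.≤-<-trans (proj₁ (∈-posns⁻ (∈P-Qˡ p))) (adj-< Q-sorted p)
    j<n : j < n
    j<n = ℕ.<-≤-trans (adj-< Q-sorted q) (proj₂ (∈-posns⁻ (∈P-Qʳ q)))
    j∉R : ¬ j ∈ R
    j∉R j∈R with ∈Q∩R (adj-∈ʳ p) j∈R
    ... | inj₁ j≡1 = ℕ.<⇒≢ 1<j (sym j≡1)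
    ... | inj₂ j≡n = ℕ.<⇒≢ j<n j≡n
    j-start : j ∈ IncPaths.starts
    j-start = IncPaths.∈-starts⁺ (∈P-Qʳ p) none (∈P-Qʳ q) (inc⁺ (inj₂ q) j<k)
      where
      none : ∀ {u} → u ∈ P → ¬ T (incEdge π u j)
      none u∈ e with inc⁻ u∈ (∈P-Qʳ p) e
      ... | inj₁ r , _  = j∉R (adj-∈ʳ r)
      ... | inj₂ r , lt with adj-prevUnique Q-sorted r p
      ...   | refl = ℕ.<-asym lt j<i
    r = proj₁ next-R
    r∈P : r ∈ P
    r∈P = proj₁ (∈R⁻ (adj-∈ʳ (proj₂ next-R)))
    q∈P : proj₁ next-Q ∈ P
    q∈P = ∈P-Qʳ (proj₂ next-Q)
    edge-r : T (incEdge π 1 r)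
    edge-r = inc⁺ (inj₁ (proj₂ next-R)) (adjR-increases (proj₂ next-R))
    edge-q : T (incEdge π 1 (proj₁ next-Q))
    edge-q = inc⁺ (inj₂ (proj₂ next-Q)) (1-minimal q∈P (adj-< Q-sorted (proj₂ next-Q)))
    1-start : 1 ∈ IncPaths.starts
    1-start = IncPaths.∈-starts⁺ 1∈P 1-initial r∈P edge-r
    two-outs : 2 ≤ length (IncPaths.outs 1)
    two-outs = unique-⊆⇒length≤ {xs = r ∷ proj₁ next-Q ∷ []}
      ((next-distinct (proj₂ next-R) (proj₂ next-Q) ∷ []) ∷ [] ∷ [])
      λ { (here refl) → IncPaths.∈-outs⁺ {1} r∈P edge-r ; (there (here refl)) → IncPaths.∈-outs⁺ {1} q∈P edge-q }
    3≤inc : 3 ≤ length (maximalPaths π (incEdge π))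
    3≤inc = ℕ.≤-trans (ℕ.+-mono-≤ (ℕ.≤-trans two-outs (IncPaths.paths-≥ (length w) 1)) (IncPaths.paths-≥1 n j))
      (length-concatMap-∈₂ (pathsFrom π n (incEdge π)) IncPaths.starts 1-start j-start (ℕ.<⇒≢ 1<j))
    1≤dec : 1 ≤ length (maximalPaths π (decEdge π))
    1≤dec = let v , v∈ = DecPaths.exists-start (λ i∈ k∈ e → adj-< Q-sorted (proj₁ (dec⁻ i∈ k∈ e))) i (∈P-Qˡ p) (∈P-Qʳ p) (dec⁺ p j<i) in
      ℕ.≤-trans (DecPaths.paths-≥1 n v) (length-concatMap-∈ (pathsFrom π n (decEdge π)) DecPaths.starts v∈)

  faces≤3⇒noValley : faces π ≤ 3 → NoValley 1 (src w)
  faces≤3⇒noValley ≤3 = subst (NoValley 1) at-Q′ (adj⇒noValley (at π) 1 Q′ λ p q → step (from-Q′ p) (from-Q′ q))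
    where
    step : ∀ {i j k} → Adj i j Q → Adj j k Q → at π j < at π i → at π k < at π j
    step {i} {j} {k} p q j<i with ℕ.<-cmp (at π j) (at π k)
    ... | tri< j<k _ _ = contradiction ≤3 (ℕ.<⇒≱ (valley⇒4≤faces p q j<i j<k))
    ... | tri≈ _ eq _  = contradiction eq (at-≢ (∈P-Qˡ q) (∈P-Qʳ q) (ℕ.<⇒≢ (adj-< Q-sorted q)))
    ... | tri> _ _ k<j = k<j

-- Counting triangular permutations

∈-prefixes⁻ : ∀ {A : Set} {ws : List (List A)} {v} xs → v ∈ concatMap (λ x → map (x ∷_) ws) xs →
              ∃ λ x → ∃ λ w → x ∈ xs × w ∈ ws × v ≡ x ∷ w
∈-prefixes⁻ {ws = ws} xs v∈ with find (∈-concatMap⁻ (λ x → map (x ∷_) ws) {xs = xs} v∈)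
... | x , x∈ , v∈′ with ∈-map⁻ (x ∷_) v∈′
...   | w , w∈ , eq = x , w , x∈ , w∈ , eq

prefixes-unique : ∀ {A : Set} {ws : List (List A)} xs → Unique xs → Unique ws → Unique (concatMap (λ x → map (x ∷_) ws) xs)
prefixes-unique []       _         _ = []
prefixes-unique (x ∷ xs) (x∉ ∷ u) u′ = Unique.++⁺ (Unique.map⁺ ∷-injectiveʳ u′) (prefixes-unique xs u u′) disjoint
  where
  disjoint : ∀ {v} → v ∈ map (x ∷_) _ × v ∈ concatMap (λ x → map (x ∷_) _) xs → ⊥
  disjoint (p , q) with ∈-map⁻ (x ∷_) p | ∈-prefixes⁻ xs q
  ... | w , _ , refl | y , _ , y∈ , _ , eq = All.lookup x∉ y∈ (∷-injectiveˡ eq)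

words-unique : ∀ k m → Unique (words k m)
words-unique zero    m = [] ∷ []
words-unique (suc k) m = prefixes-unique (posns m) (<⇒≢-unique (posns-sorted m)) (words-unique k m)

∈-words⁺ : ∀ {m} w → All (_∈ posns m) w → w ∈ words (length w) m
∈-words⁺ []      []      = here refl
∈-words⁺ {m} (x ∷ w) (x∈ ∷ a) = ∈-concatMap⁺ (λ x → map (x ∷_) (words (length w) m)) (lose x∈ (∈-map⁺ (x ∷_) (∈-words⁺ w a)))

unique-↭ : ∀ {A : Set} {xs ys : List A} → Unique xs → (∀ {x} → x ∈ xs → x ∈ ys) → length xs ≡ length ys → ys ↭ xs
unique-↭ {xs = xs} {ys} u sub eq with unique-⊆⇒↭ u sub
... | []     , p = ↭-trans p (↭-reflexive (++-identityʳ xs))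
... | z ∷ zs , p = contradiction (trans eq (trans (↭-length p) (length-++ xs))) (ℕ.m≢1+m+n (length xs) ∘ λ e → trans e (ℕ.+-suc (length xs) (length zs)))

-- `isPerm` checks the length and that every value up to m occurs; repetitions are then excluded by
-- counting, through `unique-↭`.
perm⁻ : ∀ {m π} → π ∈ perms m → π ↭ posns m
perm⁻ {m} {π} π∈ with ∧⁻ {length π ≡ᵇ m} (proj₂ (∈-filter⁻ (T? ∘ isPerm m) {xs = words m m} π∈))
... | len , every = unique-↭ (<⇒≢-unique (posns-sorted m))
  (λ {v} v∈ → Any.map (ℕ.≡ᵇ⇒≡ v _) (Any.any⁻ (λ w → v ≡ᵇ w) π (All.lookup (All.all⁺ (λ v → any (λ w → v ≡ᵇ w) π) (posns m) every) v∈)))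
  (trans (length-posns m) (sym (ℕ.≡ᵇ⇒≡ (length π) m len)))

perm⁺ : ∀ {m π} → π ↭ posns m → π ∈ perms m
perm⁺ {m} {π} p = ∈-filter⁺ (T? ∘ isPerm m)
  (subst (λ k → π ∈ words k m) len (∈-words⁺ π (All.tabulate (∈-resp-↭ p))))
  (∧⁺ (ℕ.≡⇒≡ᵇ (length π) m len)
      (All.all⁻ (λ v → any (λ w → v ≡ᵇ w) π) {xs = posns m}
        (All.tabulate λ {v} v∈ → Any.any⁺ (λ w → v ≡ᵇ w) (Any.map (λ {w} → ℕ.≡⇒≡ᵇ v w) (∈-resp-↭ (↭-sym p) v∈)))))
  where
  len : length π ≡ m
  len = trans (↭-length p) (length-posns m)

filter-enumeration : ∀ {A : Set} (p : A → Bool) {xs} → Unique xs → Enumeration (λ x → x ∈ xs × T (p x)) (length (filterᵇ p xs))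
filter-enumeration p {xs} u = record
  { elements = filterᵇ p xs
  ; unique   = Unique.filter⁺ (T? ∘ p) u
  ; sound    = ∈-filter⁻ (T? ∘ p)
  ; complete = λ (x∈ , px) → ∈-filter⁺ (T? ∘ p) x∈ px
  ; size     = refl }

perms-unique : ∀ m → Unique (perms m)
perms-unique m = Unique.filter⁺ (T? ∘ isPerm m) (words-unique m m)

from2 : ℕ → List ℕ
from2 m = applyUpTo (λ k → suc (suc k)) m

posns≡1∷from2 : ∀ m → posns (suc m) ≡ 1 ∷ from2 m
posns≡1∷from2 m = cong (1 ∷_) (map-applyUpTo suc suc m)

from2-sorted : ∀ m → Sorted (from2 m)
from2-sorted m = AllPairs.applyUpTo⁺₁ _ m (λ i<j _ → s≤s (s≤s i<j))

1<from2 : ∀ m → All (1 <_) (from2 m)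
1<from2 m = All.applyUpTo⁺₂ _ m (λ _ → s≤s (s≤s z≤n))

unique-resp-↭ : ∀ {xs ys : List ℕ} → xs ↭ ys → Unique xs → Unique ys
unique-resp-↭ p = Unique-resp-↭ (↭⇒↭ₛ p)

module _ {m} (2≤m : 2 ≤ m) where

  1<word : ∀ {w} → w ↭ from2 m → All (1 <_) w
  1<word p = All-resp-↭ (↭-sym p) (1<from2 m)

  word-unique : ∀ {w} → w ↭ from2 m → Unique w
  word-unique p = unique-resp-↭ (↭-sym p) (<⇒≢-unique (from2-sorted m))

  word-length : ∀ {w} → w ↭ from2 m → 2 ≤ length w
  word-length p = subst (2 ≤_) (sym (trans (↭-length p) (length-applyUpTo _ m))) 2≤m

  -- The leading 1 plays the part of the largest source read so far, so initially nothing is below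
  -- and the values 2 to m + 1 are above.
  triangular⇒valid : ∀ {π} → π ∈ perms (suc m) → T (triangular π) → ∃ λ w → π ≡ 1 ∷ w × Valid [] (from2 m) w
  triangular⇒valid {[]}    π∈ ()
  triangular⇒valid {x ∷ w} π∈ t = let first , f = ∧⁻ {x ≡ᵇ 1} t in
    headed (ℕ.≡ᵇ⇒≡ x 1 first) (↭-trans (perm⁻ π∈) (↭-reflexive (posns≡1∷from2 m))) (ℕ.≤ᵇ⇒≤ (faces (x ∷ w)) 3 f)
    where
    headed : ∀ {x w} → x ≡ 1 → x ∷ w ↭ 1 ∷ from2 m → faces (x ∷ w) ≤ 3 → ∃ λ v → x ∷ w ≡ 1 ∷ v × Valid [] (from2 m) v
    headed {w = w} refl p f = let q = drop-∷ p in
      w , refl , noValley⇒valid w [] (from2 m) q (from2-sorted m) [] (1<from2 m)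
        (Faces.faces≤3⇒noValley w (1<word q) (word-unique q) (word-length q) f)

  valid⇒triangular : ∀ {w} → Valid [] (from2 m) w → 1 ∷ w ∈ perms (suc m) × T (triangular (1 ∷ w))
  valid⇒triangular {w} v = let p = valid⇒↭ v in
    perm⁺ (↭-trans (↭-prep 1 p) (↭-reflexive (sym (posns≡1∷from2 m)))) ,
    ℕ.≤⇒≤ᵇ (Faces.noValley⇒faces≤3 w (1<word p) (word-unique p) (word-length p) (valid⇒noValley v (from2-sorted m) [] (1<from2 m)))

  numTriangular-completions : numTriangular (suc m) ≡ completions 0 m
  numTriangular-completions = enumeration-size
    (enumeration-cong (λ (π∈ , t) → triangular⇒valid π∈ t) (λ { (w , refl , v) → valid⇒triangular v })
      (filter-enumeration triangular (perms-unique (suc m))))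
    (enumeration-∷ 1 (subst (λ k → Enumeration (Valid [] (from2 m)) (completions 0 k)) (length-applyUpTo _ m)
      (enumerate-valid _ [] (from2 m) refl (from2-sorted m))))

-- The converse of `skips` followed by `take`: by sortedness a differs from every value before and
-- after it, so exactly `gs` has been skipped when a is read.
valid-first⁻ : ∀ {ls a ks w} gs → Sorted (gs ++ a ∷ ks) → Up ls (gs ++ a ∷ ks) (a ∷ w) → Valid (ls ++ gs) ks w
valid-first⁻ {ls} {a} {ks} {w} [] s (take v) = subst (λ xs → Valid xs ks w) (sym (++-identityʳ ls)) v
valid-first⁻ [] (a<ks ∷ _) (skip u) with up-head u
... | _ , _ , refl , a∈ = ⊥-elim (ℕ.<-irrefl refl (All.lookup a<ks a∈))
valid-first⁻ (g ∷ gs) s (take v) = ⊥-elim (ℕ.<-irrefl refl (All.head (sorted-before (g ∷ gs) s)))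
valid-first⁻ {ls} {a} {ks} {w} (g ∷ gs) (_ ∷ s) (skip u) = subst (λ xs → Valid xs ks w) (++-assoc ls (g ∷ []) gs) (valid-first⁻ gs s u)

applyUpTo-split : ∀ {A : Set} (f : ℕ → A) i q → applyUpTo f (suc (i + q)) ≡ applyUpTo f i ++ f i ∷ applyUpTo (λ k → f (suc (i + k))) q
applyUpTo-split f zero    q = refl
applyUpTo-split f (suc i) q = cong (f 0 ∷_) (applyUpTo-split (f ∘ suc) i q)

-- Reading a = i + 2 right after 1 skips the i values 2 to a - 1, which are then below, and leaves q
-- values above. The hypothesis says that the length is at least 3, as the count of faces requires.
tcount-completions : ∀ i q → 1 ≤ i + q → tcount (suc (suc (i + q))) (suc (suc i)) ≡ completions i q
tcount-completions i q 1≤i+q = enumeration-size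
  (enumeration-cong to from (filter-enumeration (λ π → triangular π ∧ (at π 1 ≡ᵇ 1) ∧ (at π 2 ≡ᵇ a)) (perms-unique (suc m))))
  (enumeration-∷ 1 (enumeration-∷ a (subst₂ (λ j k → Enumeration (Valid gs ks) (completions j k)) (length-applyUpTo _ i) (length-applyUpTo _ q)
    (enumerate-valid _ gs ks refl (sorted-remove gs sorted)))))
  where
  m = suc (i + q)
  a = suc (suc i)
  gs = from2 i
  ks = applyUpTo (λ k → suc (suc (suc (i + k)))) q
  split : from2 m ≡ gs ++ a ∷ ks
  split = applyUpTo-split (λ k → suc (suc k)) i q
  sorted : Sorted (gs ++ a ∷ ks)
  sorted = subst Sorted split (from2-sorted m)
  2≤m : 2 ≤ m
  2≤m = s≤s 1≤i+q
  Target : List ℕ → Set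
  Target π = ∃ λ v → π ≡ 1 ∷ v × ∃ λ w → v ≡ a ∷ w × Valid gs ks w
  second : ∀ {w} → Valid [] (gs ++ a ∷ ks) w → at (1 ∷ w) 2 ≡ a → ∃ λ w′ → w ≡ a ∷ w′ × Valid gs ks w′
  second {[]}    _      ()
  second {x ∷ w} (up u) refl = w , refl , valid-first⁻ gs sorted u
  to : ∀ {π} → π ∈ perms (suc m) × T (triangular π ∧ (at π 1 ≡ᵇ 1) ∧ (at π 2 ≡ᵇ a)) → Target π
  to {π} (π∈ , t) =
    let tri , t′ = ∧⁻ {triangular π} t
        w , π≡ , v = triangular⇒valid 2≤m π∈ tri
    in w , π≡ , second (subst (λ hs → Valid [] hs w) split v)
         (trans (cong (λ ρ → at ρ 2) (sym π≡)) (ℕ.≡ᵇ⇒≡ (at π 2) a (proj₂ (∧⁻ {at π 1 ≡ᵇ 1} t′))))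
  from : ∀ {π} → Target π → π ∈ perms (suc m) × T (triangular π ∧ (at π 1 ≡ᵇ 1) ∧ (at π 2 ≡ᵇ a))
  from (_ , refl , w , refl , v) =
    let π∈ , tri = valid⇒triangular 2≤m {a ∷ w} (subst (λ hs → Valid [] hs (a ∷ w)) (sym split) (up (skips gs (take v))))
    in π∈ , ∧⁺ {triangular (1 ∷ a ∷ w)} tri (ℕ.≡⇒≡ᵇ a a refl)

tcount≡completions : ∀ i q → tcount (suc (suc (i + q))) (suc (suc i)) ≡ completions i q
-- Length 2 is outside the range of the face count; the permutation 12 is checked by evaluation.
tcount≡completions zero    zero    = refl
tcount≡completions zero    (suc q) = tcount-completions 0 (suc q) (s≤s z≤n)
tcount≡completions (suc i) q       = tcount-completions (suc i) q (s≤s z≤n)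

-- The coefficients of t, and the theorem

open import Data.Integer using (+_)
open import Data.Integer.Base using (ℤ)
open GeneratingFunction using (staircase; τ; series-identity)

staircase-≤ : ∀ p i q → staircase p i (i + q) ≡ + completions (p + i) q
staircase-≤ p zero    q = cong (λ r → + completions r q) (sym (ℕ.+-identityʳ p))
staircase-≤ p (suc i) q = trans (staircase-≤ (suc p) i q) (cong (λ r → + completions r q) (sym (ℕ.+-suc p i)))

staircase-> : ∀ p {i j} → j < i → staircase p i j ≡ + 0
staircase-> p {suc i} {zero}  _         = refl
staircase-> p {suc i} {suc j} (s≤s j<i) = staircase-> (suc p) j<i

tSeries≈τ : tSeries ≈S τ
tSeries≈τ i zero          = refl
tSeries≈τ i (suc zero)    = refl
tSeries≈τ i (suc (suc j)) = trans (cong (coefficient (suc (suc j))) (ℕ.+-comm i 2)) (go i j (i ℕ.≤? j))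
  where
  coefficient : ℕ → ℕ → ℤ
  coefficient n a = if a ≤ᵇ n then + tcount n a else + 0
  below : ∀ i q {j} → i + q ≡ j → coefficient (suc (suc j)) (suc (suc i)) ≡ staircase 0 i j
  below i q refl = trans
    (cong (λ b → if b then + tcount (suc (suc (i + q))) (suc (suc i)) else + 0)
      (T-extensional {i <ᵇ suc (i + q)} {true} (λ _ → tt) (λ _ → ℕ.<⇒<ᵇ (s≤s (ℕ.m≤m+n i q)))))
    (trans (cong +_ (tcount≡completions i q)) (sym (staircase-≤ 0 i q)))
  go : ∀ i j → Dec (i ≤ j) → coefficient (suc (suc j)) (suc (suc i)) ≡ staircase 0 i j
  go i j (yes i≤j) = let q , eq = ℕ.m≤n⇒∃[o]m+o≡n i≤j in below i q eq
  go i j (no i≰j)  = trans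
    (cong (λ b → if b then + tcount (suc (suc j)) (suc (suc i)) else + 0)
      (¬T⇒≡false {i <ᵇ suc j} (λ t → i≰j (ℕ.≤-pred (ℕ.<ᵇ⇒< i (suc j) t)))))
    (sym (staircase-> 0 (ℕ.≰⇒> i≰j)))

numTriangular≡central : ∀ n → numTriangular (n + 2) ≡ (2 * n) C n
numTriangular≡central zero    = refl
numTriangular≡central (suc n) = trans (cong numTriangular (ℕ.+-comm (suc n) 2))
  (trans (numTriangular-completions {suc (suc n)} (s≤s (s≤s z≤n))) (completions-central (suc n)))

theorem4p1 : ((n : ℕ) → numTriangular (n + 2) ≡ (2 * n) C n)
    × ((Dinv Einv S : FPS) → denomD ⊛ Dinv ≈S oneS → denomE ⊛ Einv ≈S oneS
    → S 0 0 ≡ + 1 → S ⊛ S ⊛ oneMinus4x ≈S oneS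
    → tSeries ≈S numerA ⊛ Dinv ⊕ mono (+ 1) 0 3 ⊛ Einv ⊛ S)
theorem4p1 = numTriangular≡central ,
  λ Dinv Einv S D E S₀ S² i j → trans (tSeries≈τ i j) (series-identity Dinv Einv S D E S₀ S² i j)
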